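{- Fix integers $n \geq 2$ and $1\le t\le n$, and let $\alpha,\beta\in\mathbf{Q}$ satisfy $\alpha+\beta+j\neq 0$ for all integers $j$ with $n+1\le j\le 2n$ and for all integers $j$ with $2n-2t+3\le j\le 2n$. Let $\theta_1,\dots,\theta_n\in\overline{\mathbf{Q}}$ be the roots, with multiplicity, of the polynomial $\mathscr{J}_n^{(\alpha,\beta)}(x)$, let $s_k=\sum_{j=1}^n\theta_j^k$ for $k\ge 0$, and let $\Delta_t=\det(s_{i+j})_{0\le i,j\le t-1}$. Then $$\Delta_t = \frac{A_tB_t}{C_t},$$ where $$A_t=\prod_{j=n-t+1}^n j^{\,j-(n-t)},$$ $$B_t=\prod_{j=n-t+2}^n \left[(\alpha+j)(\beta+j)\right]^{j-(n-t+1)}(\alpha+\beta+j)^{j-(n-t+2)},$$ $$C_t=\prod_{j=2n-2t+2}^{2n}(\alpha+\beta+j)^{j-(2n-2t+2)}.$$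
   Context: For $n\ge 1$ and $\alpha,\beta\in\mathbf{Q}$ with $\alpha+\beta+j\ne 0$ for $n+1\le j\le 2n$, the (monic, shifted) Jacobi polynomial is $$\mathscr{J}_n^{(\alpha,\beta)}(x) = \sum_{j=0}^n \binom{n}{j}\left(\prod_{k=j+1}^n \frac{\alpha+k}{n+\alpha+\beta+k}\right)(-1)^{n-j}x^j.$$ Conventions: $\theta^0=1$ for every root $\theta$ (so $s_0=n$), empty products equal $1$, and any factor raised to the power $0$ equals $1$. -}

module Defs where

open import Algebra.Apartness.Bundles using (HeytingField; HeytingCommutativeRing)
open import Algebra.Bundles using (CommutativeRing; RawRing)
import Algebra.Definitions.RawSemiring as RawSemiringDefs
open import Algebra.Morphism.Structures using (IsRingHomomorphism)
open import Data.Fin.Base using (Fin; zero; suc; toℕ; punchIn)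
open import Data.Fin.Properties using (toℕ<n)
import Data.Integer.Base as ℤ
import Data.Integer.Properties as ℤ
open import Data.List.Base using (List; []; _∷_; map; tabulate)
open import Data.Nat.Base using (ℕ; zero; suc; _∸_; _≤_; s≤s⁻¹)
import Data.Nat.Base as ℕ
open import Data.Nat.Combinatorics using () renaming (_C_ to binomial)
import Data.Nat.Properties as ℕ
open import Data.Product.Base using (∃; ∃-syntax; _×_)
open import Data.Rational.Base using (ℚ; 0ℚ; +-*-rawRing)
open import Data.Rational.Literals using (fromℤ)
import Data.Rational.Properties as ℚ
import Data.Rational.Unnormalised.Base as ℚᵘ
import Data.Rational.Unnormalised.Properties as ℚᵘ
open import Level using (Level; _⊔_) renaming (suc to lsuc)
open import Relation.Binary.PropositionalEquality using (_≡_; _≢_; refl; sym; trans; cong; cong₂; subst; module ≡-Reasoning)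
open import Relation.Nullary.Negation.Core using (contradiction)

module Poly {c ℓ : Level} (R : RawRing c ℓ) where
  private module R = RawRing R

  -- Coefficients from the constant term upwards; trailing zeros are allowed,
  -- so polynomials are compared by _≈ₚ_.
  Polynomial : Set c
  Polynomial = List R.Carrier

  coeff : Polynomial → ℕ → R.Carrier
  coeff []      _       = R.0#
  coeff (a ∷ _) zero    = a
  coeff (_ ∷ p) (suc k) = coeff p k

  infix 4 _≈ₚ_
  _≈ₚ_ : Polynomial → Polynomial → Set ℓ
  p ≈ₚ q = ∀ k → coeff p k R.≈ coeff q k

  infixl 6 _+ₚ_
  _+ₚ_ : Polynomial → Polynomial → Polynomial
  []      +ₚ q       = q
  (a ∷ p) +ₚ []      = a ∷ p
  (a ∷ p) +ₚ (b ∷ q) = (a R.+ b) ∷ (p +ₚ q)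

  infixl 7 _·ₚ_ _*ₚ_
  _·ₚ_ : R.Carrier → Polynomial → Polynomial
  a ·ₚ p = map (a R.*_) p

  _*ₚ_ : Polynomial → Polynomial → Polynomial
  []      *ₚ q = []
  (a ∷ p) *ₚ q = (a ·ₚ q) +ₚ (R.0# ∷ (p *ₚ q))

  eval : Polynomial → R.Carrier → R.Carrier
  eval []      x = R.0#
  eval (a ∷ p) x = a R.+ x R.* eval p x

  X-_ : R.Carrier → Polynomial
  X- a = (R.- a) ∷ R.1# ∷ []

  ∏X- : ∀ {n} → (Fin n → R.Carrier) → Polynomial
  ∏X- {zero}  θ = R.1# ∷ []
  ∏X- {suc n} θ = (X- θ zero) *ₚ ∏X- (λ i → θ (suc i))

module Det {c ℓ : Level} (R : RawRing c ℓ) where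
  open RawRing R
  open RawSemiringDefs rawSemiring using (_^_; sum)

  -- Laplace expansion along the first row.
  det : ∀ {n} → (Fin n → Fin n → Carrier) → Carrier
  det {zero}  M = 1#
  det {suc n} M = sum λ j → (- 1#) ^ toℕ j * M zero j * det (λ i k → M (suc i) (punchIn j k))

record AlgebraicClosureOfℚ (c ℓ₁ ℓ₂ : Level) : Set (lsuc (c ⊔ ℓ₁ ⊔ ℓ₂)) where
  field
    heytingField : HeytingField c ℓ₁ ℓ₂

  open HeytingField heytingField public
    using (Carrier; _≈_; _#_; 0#)

  commutativeRing : CommutativeRing c ℓ₁
  commutativeRing = HeytingCommutativeRing.commutativeRing (HeytingField.heytingCommutativeRing heytingField)

  rawRing : RawRing c ℓ₁
  rawRing = CommutativeRing.rawRing commutativeRing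

  open Poly rawRing public
  open Det rawRing public
  open RawSemiringDefs (RawRing.rawSemiring rawRing) public using (_^_; sum)

  field
    ι                    : ℚ → Carrier
    ι-isRingHomomorphism : IsRingHomomorphism +-*-rawRing rawRing ι
    algebraic            : ∀ x → ∃[ p ] (∃[ k ] Poly.coeff +-*-rawRing p k ≢ 0ℚ) × eval (map ι p) x ≈ 0#
    algebraicallyClosed  : ∀ p → (∃[ k ] coeff p (suc k) # 0#) → ∃[ x ] eval p x ≈ 0#

  -- θ lists the roots of p, each repeated according to its multiplicity.
  AreRootsOf : ∀ {n} → (Fin n → Carrier) → Polynomial → Set (c ⊔ ℓ₁ ⊔ ℓ₂)
  AreRootsOf θ p = ∃[ a ] a # 0# × p ≈ₚ a ·ₚ ∏X- θ

  powerSum : ∀ {n} → (Fin n → Carrier) → ℕ → Carrier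
  powerSum θ k = sum λ j → θ j ^ k

  Δ : ∀ {n} → (Fin n → Carrier) → ℕ → Carrier
  Δ θ t = det {t} λ i j → powerSum θ (toℕ i ℕ.+ toℕ j)

open import Data.Rational.Base using (1ℚ; _+_; _*_; -_; _÷_; 1/_; NonZero; ≢-nonZero)
open RawSemiringDefs (RawRing.rawSemiring +-*-rawRing) using (_^_; product)

fromℕ : ℕ → ℚ
fromℕ k = fromℤ (ℤ.+ k)

inRange : ∀ lo hi (i : Fin (suc hi ∸ lo)) → lo ℕ.+ toℕ i ≤ hi
inRange lo hi i = s≤s⁻¹ (subst (lo ℕ.+ toℕ i ℕ.<_) (ℕ.m+[n∸m]≡n lo≤1+hi) (ℕ.+-monoʳ-< lo (toℕ<n i)))
  where
  lo≤1+hi : lo ≤ suc hi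
  lo≤1+hi = ℕ.<⇒≤ (ℕ.m∸n≢0⇒n<m (ℕ.m<n⇒n≢0 (toℕ<n i)))

-- The product of f k over lo ≤ k ≤ hi, equal to 1 when hi < lo.  The factors may
-- use the bounds on k, so that they can be quotients whose denominators are known
-- to be nonzero only in that range.
∏ᵇ : (lo hi : ℕ) → (∀ k → lo ≤ k → k ≤ hi → ℚ) → ℚ
∏ᵇ lo hi f = product {suc hi ∸ lo} λ i → f (lo ℕ.+ toℕ i) (ℕ.m≤m+n lo (toℕ i)) (inRange lo hi i)

∏[_⋯_] : (lo hi : ℕ) → (ℕ → ℚ) → ℚ
∏[ lo ⋯ hi ] f = ∏ᵇ lo hi λ k _ _ → f k

fromℕ-+ : ∀ m n → fromℕ (m ℕ.+ n) ≡ fromℕ m + fromℕ n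
fromℕ-+ m n = ℚ.toℚᵘ-injective (ℚᵘ.≃-trans (ℚᵘ.*≡* (cong (ℤ._* ℤ.1ℤ) eq)) (ℚᵘ.≃-sym (ℚ.toℚᵘ-homo-+ (fromℕ m) (fromℕ n))))
  where
  eq : ℤ.+ (m ℕ.+ n) ≡ ℤ.+ m ℤ.* ℤ.1ℤ ℤ.+ ℤ.+ n ℤ.* ℤ.1ℤ
  eq = sym (cong₂ ℤ._+_ (ℤ.*-identityʳ (ℤ.+ m)) (ℤ.*-identityʳ (ℤ.+ n)))

module _ (n : ℕ) (α β : ℚ) (α+β+j≢0 : ∀ j → n ℕ.+ 1 ≤ j → j ≤ 2 ℕ.* n → α + β + fromℕ j ≢ 0ℚ) where

  jacobiDenominator-nonZero : ∀ k → 1 ≤ k → k ≤ n → NonZero (fromℕ n + α + β + fromℕ k)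
  jacobiDenominator-nonZero k 1≤k k≤n = ≢-nonZero λ eq →
    α+β+j≢0 (n ℕ.+ k) (ℕ.+-monoʳ-≤ n 1≤k) (ℕ.+-monoʳ-≤ n (ℕ.≤-trans k≤n (ℕ.m≤m+n n 0))) (trans rearrange eq)
    where
    open ≡-Reasoning
    rearrange : α + β + fromℕ (n ℕ.+ k) ≡ fromℕ n + α + β + fromℕ k
    rearrange = begin
      α + β + fromℕ (n ℕ.+ k)       ≡⟨ cong (α + β +_) (fromℕ-+ n k) ⟩
      α + β + (fromℕ n + fromℕ k)   ≡⟨ ℚ.+-assoc (α + β) (fromℕ n) (fromℕ k) ⟨
      α + β + fromℕ n + fromℕ k     ≡⟨ cong (_+ fromℕ k) (ℚ.+-comm (α + β) (fromℕ n)) ⟩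
      fromℕ n + (α + β) + fromℕ k   ≡⟨ cong (_+ fromℕ k) (ℚ.+-assoc (fromℕ n) α β) ⟨
      fromℕ n + α + β + fromℕ k     ∎

  jacobiCoeff : ℕ → ℚ
  jacobiCoeff j = fromℕ (binomial n j) * ∏ᵇ (suc j) n factor * (- 1ℚ) ^ (n ∸ j)
    where
    factor : ∀ k → suc j ≤ k → k ≤ n → ℚ
    factor k j<k k≤n = _÷_ (α + fromℕ k) (fromℕ n + α + β + fromℕ k)
      {{jacobiDenominator-nonZero k (ℕ.≤-trans (ℕ.s≤s ℕ.z≤n) j<k) k≤n}}

  jacobi : List ℚ
  jacobi = tabulate {n = suc n} λ j → jacobiCoeff (toℕ j)

A : (n t : ℕ) → ℚ
A n t = ∏[ n ∸ t ℕ.+ 1 ⋯ n ] λ j → fromℕ j ^ (j ∸ (n ∸ t))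

B : (n t : ℕ) (α β : ℚ) → ℚ
B n t α β = ∏[ n ∸ t ℕ.+ 2 ⋯ n ] λ j →
  ((α + fromℕ j) * (β + fromℕ j)) ^ (j ∸ (n ∸ t ℕ.+ 1)) * (α + β + fromℕ j) ^ (j ∸ (n ∸ t ℕ.+ 2))

C : (n t : ℕ) (α β : ℚ) → ℚ
C n t α β = ∏[ 2 ℕ.* n ∸ 2 ℕ.* t ℕ.+ 2 ⋯ 2 ℕ.* n ] λ j →
  (α + β + fromℕ j) ^ (j ∸ (2 ℕ.* n ∸ 2 ℕ.* t ℕ.+ 2))

*-≢0 : ∀ {p q} → p ≢ 0ℚ → q ≢ 0ℚ → p * q ≢ 0ℚ
*-≢0 {p} {q} p≢0 q≢0 pq≡0 = q≢0 (begin
  q               ≡⟨ ℚ.*-identityˡ q ⟨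
  1ℚ * q          ≡⟨ cong (_* q) (ℚ.*-inverseˡ p) ⟨
  1/ p * p * q    ≡⟨ ℚ.*-assoc (1/ p) p q ⟩
  1/ p * (p * q)  ≡⟨ cong (1/ p *_) pq≡0 ⟩
  1/ p * 0ℚ       ≡⟨ ℚ.*-zeroʳ (1/ p) ⟩
  0ℚ              ∎)
  where
  open ≡-Reasoning
  instance _ = ≢-nonZero p≢0

product-≢0 : ∀ {m} (f : Fin m → ℚ) → (∀ i → f i ≢ 0ℚ) → product f ≢ 0ℚ
product-≢0 {zero}  f f≢0 = λ ()
product-≢0 {suc m} f f≢0 = *-≢0 (f≢0 zero) (product-≢0 (λ i → f (suc i)) (λ i → f≢0 (suc i)))

^-≢0 : ∀ {p} → p ≢ 0ℚ → ∀ k → p ^ k ≢ 0ℚ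
^-≢0 p≢0 zero    = λ ()
^-≢0 p≢0 (suc k) = *-≢0 p≢0 (^-≢0 p≢0 k)

C-nonZero : ∀ n t α β →
  (∀ j → 2 ℕ.* n ∸ 2 ℕ.* t ℕ.+ 3 ≤ j → j ≤ 2 ℕ.* n → α + β + fromℕ j ≢ 0ℚ) →
  NonZero (C n t α β)
C-nonZero n t α β α+β+j≢0 = ≢-nonZero (product-≢0 {suc hi ∸ lo} _ λ i → factor≢0 (toℕ i) (inRange lo hi i))
  where
  lo hi : ℕ
  lo = 2 ℕ.* n ∸ 2 ℕ.* t ℕ.+ 2
  hi = 2 ℕ.* n

  factor≢0 : ∀ i → lo ℕ.+ i ≤ hi → (α + β + fromℕ (lo ℕ.+ i)) ^ (lo ℕ.+ i ∸ lo) ≢ 0ℚ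
  factor≢0 zero _ eq = contradiction (trans (cong (x ^_) (sym (ℕ.m+n∸m≡n lo 0))) eq) λ ()
    where x = α + β + fromℕ (lo ℕ.+ 0)
  factor≢0 (suc i) le = ^-≢0 (α+β+j≢0 (lo ℕ.+ suc i) ge le) (lo ℕ.+ suc i ∸ lo)
    where
    ge : 2 ℕ.* n ∸ 2 ℕ.* t ℕ.+ 3 ≤ lo ℕ.+ suc i
    ge = subst (ℕ._≤ lo ℕ.+ suc i) (ℕ.+-assoc (2 ℕ.* n ∸ 2 ℕ.* t) 2 1) (ℕ.+-monoʳ-≤ lo (ℕ.s≤s ℕ.z≤n))

-- Reversing the coefficients turns 𝒥ₙ into F = ∏ (1 − θᵢ z), which is the hypergeometric
-- polynomial ₂F₁(a, b; c; z) with a = −n, b = −n − α, c = −2n − α − β, and Newton's identities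
-- give Σ sₖ zᵏ = n ₂F₁(a + 1, b; c; z) / F. Gauss's contiguous relations expand this quotient
-- into an S-fraction with explicit coefficients cₖ. Euclid's algorithm along the fraction is a
-- unitriangular column operation that makes the Hankel matrix (sᵢ₊ⱼ) lower triangular with
-- diagonal entries n c₀ ⋯ c₂ᵢ₋₁, so Δₜ is their product. Only the cₖ with k < 2t − 2 and the
-- coefficients of the series up to order 2t − 2 enter, and these are the ones whose
-- denominators are nonzero by hypothesis.
module Submission where

open import Defs
open import Algebra.Bundles using (CommutativeRing; RawRing; Semiring)
import Algebra.Definitions.RawSemiring as RawSemiringDefs
open import Algebra.Morphism.Structures using (IsRingHomomorphism)
import Algebra.Properties.CommutativeSemiring.Exp as Exp
open import Data.Fin.Base using (Fin; zero; suc; toℕ; fromℕ<; inject₁; punchIn; punchOut)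
import Data.Fin.Base as Fin
import Data.Fin.Properties as Fin
open import Data.List.Base using ([]; _∷_; map; tabulate)
open import Data.Nat.Base using (ℕ; zero; suc; _≤_; _∸_; _!; z≤n; s≤s)
import Data.Nat.Base as ℕ
open import Data.Nat.Combinatorics using (nCn≡1; k![n∸k]!∣n!) renaming (_C_ to binomial)
open import Data.Nat.Combinatorics.Specification using (nCk≡n!/k![n-k]!)
open import Data.Nat.DivMod using (m/n*n≡m)
import Data.Nat.Properties as ℕ
open import Data.Nat.Solver using () renaming (module +-*-Solver to ℕ-Solver)
open import Data.Product.Base using (∃-syntax; _×_; _,_; proj₁; proj₂)
open import Data.Sum.Base using (_⊎_; inj₁; inj₂)
open import Data.Vec.Functional using (updateAt)
open import Data.Vec.Functional.Properties using (updateAt-updates; updateAt-minimal)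
open import Function.Base using (_∘_; const)
open import Relation.Binary.Definitions using (tri<; tri≈; tri>)
open import Relation.Binary.PropositionalEquality as ≡ using (_≡_; _≢_; module ≡-Reasoning)
open import Relation.Nullary.Decidable using (yes; no)
open import Relation.Nullary.Negation using (contradiction)

-- Determinants

-- No coefficient cₖ can be assumed nonzero: some vanish, for example, when α + j = 0 for some n - t
-- + 2 ≤ j ≤ n, and the fraction then stops early. The elimination therefore never divides by a
-- coefficient. Each step adds cₖ times the older column to the newer one, which keeps the column
-- polynomials monic and moves the cₖ into the pivots. Likewise H₀ is never inverted: a statement on
-- f = g / H₀ is proved as one on f H₀ = g, and since H₀ has constant term 1, f and f H₀ have the
-- same order and the same leading coefficient. The numerator n ₂F₁(a + 1, b; c; z) is n F - z F′.
-- Passing from F to it multiplies the coefficient of zʲ by n - j = -(a + j), and (a + j) (a)ⱼ = a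
-- (a + 1)ⱼ with a = -n.

adjacent-punchIn : ∀ {n} (j : Fin (suc (suc n))) (k : Fin (suc n)) → j ≢ inject₁ k → j ≢ suc k →
  ∃[ l ] punchIn j (inject₁ {n} l) ≡ inject₁ k × punchIn j (suc l) ≡ suc k
adjacent-punchIn zero          zero    j≢k _ = contradiction ≡.refl j≢k
adjacent-punchIn zero          (suc k) _   _ = k , ≡.refl , ≡.refl
adjacent-punchIn (suc zero)    zero    _   j≢1+k = contradiction ≡.refl j≢1+k
adjacent-punchIn {suc n} (suc (suc j)) zero    _   _ = zero , ≡.refl , ≡.refl
adjacent-punchIn {suc n} (suc j)       (suc k) j≢k j≢1+k
  with l , p , q ← adjacent-punchIn j k (j≢k ∘ ≡.cong suc) (j≢1+k ∘ ≡.cong suc)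
  = suc l , ≡.cong suc p , ≡.cong suc q

module Determinant {c ℓ} (R : CommutativeRing c ℓ) where
  open CommutativeRing R hiding (zero)
  open import Algebra.Definitions.RawSemiring (Semiring.rawSemiring semiring) using (_^_; product)
  open import Algebra.Properties.Ring ring using (-1*x≈-x)
  open import Algebra.Properties.Group +-group using (identityʳ-unique)
  open import Algebra.Properties.Semiring.Sum semiring
    using (sum; sum-cong-≋; ∑-distrib-+; *-distribˡ-sum; sum-replicate-zero)
  open import Algebra.Solver.Ring.NaturalCoefficients.Default commutativeSemiring
    using (solve; _:=_; _:+_; _:*_)
  open import Relation.Binary.Reasoning.Setoid setoid
  open Det rawRing using (det)

  Matrix : ℕ → Set c
  Matrix n = Fin n → Fin n → Carrier

  sum-zero : ∀ {n} {f : Fin n → Carrier} → (∀ i → f i ≈ 0#) → sum f ≈ 0#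
  sum-zero {n} f≈0 = trans (sum-cong-≋ f≈0) (sum-replicate-zero n)

  sum-single : ∀ {n} (f : Fin n → Carrier) k → (∀ i → i ≢ k → f i ≈ 0#) → sum f ≈ f k
  sum-single f zero    f≈0 = trans (+-congˡ (sum-zero λ i → f≈0 (suc i) λ ())) (+-identityʳ _)
  sum-single f (suc k) f≈0 = trans (+-cong (f≈0 zero λ ()) (sum-single (f ∘ suc) k λ i i≢k → f≈0 (suc i) (i≢k ∘ Fin.suc-injective))) (+-identityˡ _)

  sum-adjacent-cancel : ∀ {n} (f : Fin (suc n) → Carrier) k →
    (∀ j → j ≢ inject₁ k → j ≢ suc k → f j ≈ 0#) → f (inject₁ k) + f (suc k) ≈ 0# → sum f ≈ 0#
  sum-adjacent-cancel f zero f≈0 cancel = begin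
    f zero + (f (suc zero) + sum (λ i → f (suc (suc i))))  ≈⟨ +-congˡ (+-congˡ (sum-zero λ i → f≈0 (suc (suc i)) (λ ()) λ ())) ⟩
    f zero + (f (suc zero) + 0#)                           ≈⟨ +-congˡ (+-identityʳ _) ⟩
    f zero + f (suc zero)                                  ≈⟨ cancel ⟩
    0#                                                     ∎
  sum-adjacent-cancel f (suc k) f≈0 cancel =
    trans (+-cong (f≈0 zero (λ ()) λ ()) (sum-adjacent-cancel (f ∘ suc) k
      (λ j p q → f≈0 (suc j) (p ∘ Fin.suc-injective) (q ∘ Fin.suc-injective)) cancel)) (+-identityˡ _)

  minor : ∀ {n} → Matrix (suc n) → Fin (suc n) → Matrix n
  minor M j i k = M (suc i) (punchIn j k)

  term : ∀ {n} → Matrix (suc n) → Fin (suc n) → Carrier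
  term M j = (- 1#) ^ toℕ j * M zero j * det (minor M j)

  det-cong : ∀ {n} {M N : Matrix n} → (∀ i j → M i j ≈ N i j) → det M ≈ det N
  det-cong {zero}  M≈N = refl
  det-cong {suc n} M≈N = sum-cong-≋ λ j →
    *-cong (*-congˡ {(- 1#) ^ toℕ j} (M≈N zero j)) (det-cong λ i k → M≈N (suc i) (punchIn j k))

  -- The expansion runs along the first row, so linearity in column `k` splits by terms. At `j = k`
  -- the varying column is deleted from the minor and only the entry is linear; elsewhere the entry
  -- is common and the minor is linear by induction, in its column `punchOut j≢k`.
  det-linear : ∀ {n} {L M N : Matrix n} k c → (∀ i → L i k ≈ M i k + c * N i k) →
    (∀ i j → j ≢ k → L i j ≈ M i j) → (∀ i j → j ≢ k → L i j ≈ N i j) → det L ≈ det M + c * det N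
  det-linear {suc n} {L} {M} {N} k c Lₖ L≈M L≈N = begin
    sum (term L)                            ≈⟨ sum-cong-≋ term-linear ⟩
    sum (λ j → term M j + c * term N j)     ≈⟨ ∑-distrib-+ (term M) (λ j → c * term N j) ⟩
    sum (term M) + sum (λ j → c * term N j) ≈⟨ +-congˡ (*-distribˡ-sum c (term N)) ⟨
    sum (term M) + c * sum (term N)         ∎
    where
    term-linear : ∀ j → term L j ≈ term M j + c * term N j
    term-linear j with j Fin.≟ k
    ... | yes ≡.refl = begin
      s * L zero j * det (minor L j)                         ≈⟨ *-congʳ (*-congˡ (Lₖ zero)) ⟩
      s * (M zero j + c * N zero j) * det (minor L j)        ≈⟨ solve 5 (λ s m c n d → s :* (m :+ c :* n) :* d := s :* m :* d :+ c :* (s :* n :* d)) refl s (M zero j) c (N zero j) (det (minor L j)) ⟩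
      s * M zero j * det (minor L j) + c * (s * N zero j * det (minor L j))
        ≈⟨ +-cong (*-congˡ (det-cong λ i l → L≈M (suc i) _ (Fin.punchInᵢ≢i j l))) (*-congˡ (*-congˡ (det-cong λ i l → L≈N (suc i) _ (Fin.punchInᵢ≢i j l)))) ⟩
      term M j + c * term N j                                ∎
      where s = (- 1#) ^ toℕ j
    ... | no j≢k = begin
      s * L zero j * det (minor L j)                               ≈⟨ *-congˡ minor-linear ⟩
      s * L zero j * (det (minor M j) + c * det (minor N j))       ≈⟨ solve 5 (λ s l c m n → s :* l :* (m :+ c :* n) := s :* l :* m :+ c :* (s :* l :* n)) refl s (L zero j) c (det (minor M j)) (det (minor N j)) ⟩
      s * L zero j * det (minor M j) + c * (s * L zero j * det (minor N j))
        ≈⟨ +-cong (*-congʳ (*-congˡ (L≈M zero j j≢k))) (*-congˡ (*-congʳ (*-congˡ (L≈N zero j j≢k)))) ⟩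
      term M j + c * term N j                                      ∎
      where
      s = (- 1#) ^ toℕ j
      k′ = punchOut j≢k
      k′≡k : punchIn j k′ ≡ k
      k′≡k = Fin.punchIn-punchOut j≢k
      off : ∀ {l} → l ≢ k′ → punchIn j l ≢ k
      off l≢k′ eq = l≢k′ (Fin.punchIn-injective j _ _ (≡.trans eq (≡.sym k′≡k)))
      minor-linear : det (minor L j) ≈ det (minor M j) + c * det (minor N j)
      minor-linear = det-linear k′ c
        (λ i → ≡.subst (λ l → L (suc i) l ≈ M (suc i) l + c * N (suc i) l) (≡.sym k′≡k) (Lₖ (suc i)))
        (λ i l l≢k′ → L≈M (suc i) _ (off l≢k′)) (λ i l l≢k′ → L≈N (suc i) _ (off l≢k′))

  -- A zero column is its own double, so linearity with all three matrices equal to `M` gives d + d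
  -- = d.
  det-zeroColumn : ∀ {n} {M : Matrix n} k → (∀ i → M i k ≈ 0#) → det M ≈ 0#
  det-zeroColumn {M = M} k Mₖ≈0 = identityʳ-unique (det M) (det M) (begin
    det M + det M       ≈⟨ +-congˡ (*-identityˡ _) ⟨
    det M + 1# * det M  ≈⟨ det-linear k 1# (λ i → trans (Mₖ≈0 i) (sym (trans (+-cong (Mₖ≈0 i) (trans (*-identityˡ _) (Mₖ≈0 i))) (+-identityʳ 0#)))) (λ _ _ _ → refl) (λ _ _ _ → refl) ⟨
    det M               ∎)

  infixl 8 _[_]≔_
  _[_]≔_ : ∀ {n} → Matrix n → Fin n → (Fin n → Carrier) → Matrix n
  (M [ k ]≔ v) i = updateAt (M i) k (const (v i))

  ≔-at : ∀ {n} (M : Matrix n) k v i → (M [ k ]≔ v) i k ≈ v i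
  ≔-at M k v i = reflexive (updateAt-updates k (M i))

  ≔-off : ∀ {n} (M : Matrix n) k v i {j} → j ≢ k → (M [ k ]≔ v) i j ≈ M i j
  ≔-off M k v i {j} j≢k = reflexive (updateAt-minimal j k (M i) j≢k)

  det-≔-+ : ∀ {n} (M : Matrix n) k c (u v w : Fin n → Carrier) → (∀ i → u i ≈ v i + c * w i) →
    det (M [ k ]≔ u) ≈ det (M [ k ]≔ v) + c * det (M [ k ]≔ w)
  det-≔-+ M k c u v w u≈v+cw = det-linear k c
    (λ i → trans (≔-at M k u i) (trans (u≈v+cw i) (sym (+-cong (≔-at M k v i) (*-congˡ (≔-at M k w i))))))
    (λ i j j≢k → trans (≔-off M k u i j≢k) (sym (≔-off M k v i j≢k)))
    (λ i j j≢k → trans (≔-off M k u i j≢k) (sym (≔-off M k w i j≢k)))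

  det-≔-sum : ∀ {n m} (M : Matrix n) k (c : Fin m → Carrier) (v : Fin m → Fin n → Carrier) →
    det (M [ k ]≔ λ i → sum λ r → c r * v r i) ≈ sum λ r → c r * det (M [ k ]≔ v r)
  det-≔-sum {m = zero}  M k c v = det-zeroColumn k (≔-at M k _)
  det-≔-sum {m = suc m} M k c v = begin
    det (M [ k ]≔ λ i → c zero * v zero i + rest i)          ≈⟨ det-≔-+ M k (c zero) _ rest (v zero) (λ i → +-comm _ _) ⟩
    det (M [ k ]≔ rest) + c zero * det (M [ k ]≔ v zero)     ≈⟨ +-comm _ _ ⟩
    c zero * det (M [ k ]≔ v zero) + det (M [ k ]≔ rest)     ≈⟨ +-congˡ (det-≔-sum M k (c ∘ suc) (v ∘ suc)) ⟩
    c zero * det (M [ k ]≔ v zero) + sum (λ r → c (suc r) * det (M [ k ]≔ v (suc r))) ∎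
    where rest = λ i → sum λ r → c (suc r) * v (suc r) i

  minor-adjacent : ∀ {n} {A : Fin (suc n) → Carrier} (k : Fin n) → A (inject₁ k) ≈ A (suc k) →
    ∀ l → A (punchIn (inject₁ k) l) ≈ A (punchIn (suc k) l)
  minor-adjacent zero    eq zero    = sym eq
  minor-adjacent zero    eq (suc l) = refl
  minor-adjacent (suc k) eq zero    = refl
  minor-adjacent {A = A} (suc k) eq (suc l) = minor-adjacent {A = A ∘ suc} k eq l

  -- The terms at `inject₁ k` and `suc k` have equal minors and opposite signs. In every other minor
  -- the two columns survive side by side, at the position supplied by `adjacent-punchIn`, and
  -- induction applies.
  det-adjacent : ∀ {n} (M : Matrix (suc n)) k → (∀ i → M i (inject₁ k) ≈ M i (suc k)) → det M ≈ 0#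
  det-adjacent {suc n} M k eq = sum-adjacent-cancel (term M) k
    (λ j j≢k j≢1+k → let l , p , q = adjacent-punchIn j k j≢k j≢1+k in
      trans (*-congˡ {(- 1#) ^ toℕ j * M zero j} (det-adjacent (minor M j) l λ i →
        trans (reflexive (≡.cong (M (suc i)) p)) (trans (eq (suc i)) (reflexive (≡.cong (M (suc i)) (≡.sym q))))))
        (zeroʳ _))
    (begin
      (- 1#) ^ toℕ (inject₁ k) * M zero (inject₁ k) * det (minor M (inject₁ k)) + - 1# * s * M zero (suc k) * d
        ≈⟨ +-congʳ (*-cong (*-cong (reflexive (≡.cong ((- 1#) ^_) (Fin.toℕ-inject₁ k))) (eq zero)) (det-cong λ i → minor-adjacent {A = M (suc i)} k (eq (suc i)))) ⟩
      s * M zero (suc k) * d + - 1# * s * M zero (suc k) * d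
        ≈⟨ solve 4 (λ n s m d → s :* m :* d :+ n :* s :* m :* d := s :* m :* d :+ n :* (s :* m :* d)) refl (- 1#) s (M zero (suc k)) d ⟩
      s * M zero (suc k) * d + - 1# * (s * M zero (suc k) * d)  ≈⟨ +-congˡ (-1*x≈-x _) ⟩
      s * M zero (suc k) * d + - (s * M zero (suc k) * d)       ≈⟨ -‿inverseʳ _ ⟩
      0#                                                        ∎)
    where
    s = (- 1#) ^ toℕ k
    d = det (minor M (suc k))

  ≔-self : ∀ {n} (M : Matrix n) k {v : Fin n → Carrier} → (∀ i → v i ≈ M i k) → ∀ i j → (M [ k ]≔ v) i j ≈ M i j
  ≔-self M k {v} v≈Mₖ i j with j Fin.≟ k
  ... | yes ≡.refl = trans (≔-at M k v i) (v≈Mₖ i)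
  ... | no j≢k     = ≔-off M k v i j≢k

  -- Induction on the distance between the two equal columns: with x the left
  -- neighbour of the right-hand copy a, expand the determinant having x + a in both
  -- of these places.
  det-alternating-gap : ∀ d {n} (M : Matrix (suc n)) j k → toℕ k ≡ suc d ℕ.+ toℕ j →
    (∀ i → M i j ≈ M i k) → det M ≈ 0#
  det-alternating-gap zero M j (suc k) gap eq = det-adjacent M k
    λ i → trans (reflexive (≡.cong (M i) (Fin.toℕ-injective (≡.trans (Fin.toℕ-inject₁ k) (ℕ.suc-injective gap))))) (eq i)
  det-alternating-gap (suc d) {n} M j (suc k) gap eq = begin
    det M                                       ≈⟨ det-cong (≔-self M Q λ _ → refl) ⟨
    det (M [ Q ]≔ a)                            ≈⟨ *-identityˡ _ ⟨
    1# * det (M [ Q ]≔ a)                       ≈⟨ +-identityˡ _ ⟨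
    0# + 1# * det (M [ Q ]≔ a)                  ≈⟨ +-congʳ (det-adjacent (M [ Q ]≔ x) k λ i → trans (≔-off M Q x i P≢Q) (sym (≔-at M Q x i))) ⟨
    det (M [ Q ]≔ x) + 1# * det (M [ Q ]≔ a)    ≈⟨ det-≔-+ M Q 1# w x a w≈x+a ⟨
    det W                                       ≈⟨ det-cong (≔-self W P λ i → sym (≔-off M Q w i P≢Q)) ⟨
    det (W [ P ]≔ x)                            ≈⟨ +-identityʳ _ ⟨
    det (W [ P ]≔ x) + 0#                       ≈⟨ +-congˡ (trans (*-congˡ (det-alternating-gap d (W [ P ]≔ a) j P gap′ j≈P)) (zeroʳ 1#)) ⟨
    det (W [ P ]≔ x) + 1# * det (W [ P ]≔ a)    ≈⟨ det-≔-+ W P 1# w x a w≈x+a ⟨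
    det (W [ P ]≔ w)                            ≈⟨ det-adjacent (W [ P ]≔ w) k (λ i → trans (≔-at W P w i) (sym (trans (≔-off W P w i (P≢Q ∘ ≡.sym)) (≔-at M Q w i)))) ⟩
    0#                                          ∎
    where
    P Q : Fin (suc n)
    P = inject₁ k
    Q = suc k
    a x w : Fin (suc n) → Carrier
    a i = M i Q
    x i = M i P
    w i = x i + a i
    W = M [ Q ]≔ w
    w≈x+a : ∀ i → w i ≈ x i + 1# * a i
    w≈x+a i = +-congˡ (sym (*-identityˡ _))
    P≢Q : P ≢ Q
    P≢Q eq = ℕ.1+n≢n (≡.sym (≡.trans (≡.sym (Fin.toℕ-inject₁ k)) (≡.cong toℕ eq)))
    gap′ : toℕ P ≡ suc d ℕ.+ toℕ j
    gap′ = ≡.trans (Fin.toℕ-inject₁ k) (ℕ.suc-injective gap)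
    j≢P : j ≢ P
    j≢P eq = ℕ.<⇒≢ (s≤s (ℕ.m≤n+m (toℕ j) d)) (≡.trans (≡.cong toℕ eq) gap′)
    j≢Q : j ≢ Q
    j≢Q eq = ℕ.<⇒≢ (s≤s (ℕ.m≤n+m (toℕ j) (suc d))) (≡.trans (≡.cong toℕ eq) gap)
    j≈P : ∀ i → (W [ P ]≔ a) i j ≈ (W [ P ]≔ a) i P
    j≈P i = trans (≔-off W P a i j≢P) (trans (≔-off M Q w i j≢Q) (trans (eq i) (sym (≔-at W P a i))))

  det-alternating : ∀ {n} (M : Matrix n) {j k} → j ≢ k → (∀ i → M i j ≈ M i k) → det M ≈ 0#
  det-alternating {suc n} M {j} {k} j≢k eq with Fin.<-cmp j k
  ... | tri< j<k _ _ = det-alternating-gap (toℕ k ∸ suc (toℕ j)) M j k (≡.sym (≡.trans (≡.sym (ℕ.+-suc _ _)) (ℕ.m∸n+n≡m j<k))) eq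
  ... | tri≈ _ j≡k _ = contradiction j≡k j≢k
  ... | tri> _ _ k<j = det-alternating-gap (toℕ j ∸ suc (toℕ k)) M k j (≡.sym (≡.trans (≡.sym (ℕ.+-suc _ _)) (ℕ.m∸n+n≡m k<j))) (sym ∘ eq)

  -- Linearity expands column `k` over the columns of `M`. A term with `m ≢ k` repeats a column and
  -- vanishes; the term `m = k` has coefficient 1.
  det-combination : ∀ {n} (M N : Matrix n) k (u : Fin n → Carrier) → u k ≈ 1# →
    (∀ i → N i k ≈ sum λ m → u m * M i m) → (∀ i j → j ≢ k → N i j ≈ M i j) → det N ≈ det M
  det-combination M N k u uₖ≈1 Nₖ N≈M = begin
    det N                                           ≈⟨ det-cong N≈ ⟩
    det (M [ k ]≔ v)                                ≈⟨ det-≔-sum M k u (λ m i → M i m) ⟩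
    sum f                                           ≈⟨ sum-single f k (λ m m≢k → trans (*-congˡ (repeated m m≢k)) (zeroʳ _)) ⟩
    u k * det (M [ k ]≔ λ i → M i k)                ≈⟨ *-cong uₖ≈1 (det-cong (≔-self M k λ _ → refl)) ⟩
    1# * det M                                      ≈⟨ *-identityˡ _ ⟩
    det M                                           ∎
    where
    f = λ m → u m * det (M [ k ]≔ λ i → M i m)
    v = λ i → sum λ m → u m * M i m
    N≈ : ∀ i j → N i j ≈ (M [ k ]≔ v) i j
    N≈ i j with j Fin.≟ k
    ... | yes ≡.refl = trans (Nₖ i) (sym (≔-at M k v i))
    ... | no j≢k     = trans (N≈M i j j≢k) (sym (≔-off M k v i j≢k))
    repeated : ∀ m → m ≢ k → det (M [ k ]≔ λ i → M i m) ≈ 0#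
    repeated m m≢k = det-alternating _ m≢k λ i → trans (≔-off M k (λ i → M i m) i m≢k) (sym (≔-at M k (λ i → M i m) i))

  det-unitriangular : ∀ {n} (M N U : Matrix n) → (∀ j → U j j ≈ 1#) → (∀ m j → toℕ j ℕ.< toℕ m → U m j ≈ 0#) →
    (∀ i j → N i j ≈ sum λ m → U m j * M i m) → det N ≈ det M
  det-unitriangular {n} M N U Uⱼⱼ≈1 U≈0 N≈MU = trans (det-cong λ i j → sym (mix-≤ 0 i j z≤n)) (trans (sweep n ℕ.≤-refl) (det-cong λ i j → mix-> n i j (Fin.toℕ<n j)))
    where
    -- The first `r` columns come from `M`, the others from `N`. Going from `r` to `suc r` uses the
    -- expansion of column `r` of `N`: by triangularity it involves only columns up to `r`, and
    -- those are columns of `M` in `mix (suc r)`.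
    mix : ℕ → Matrix n
    mix r i j with r ℕ.≤? toℕ j
    ... | yes _ = N i j
    ... | no _  = M i j

    mix-≤ : ∀ r i j → r ≤ toℕ j → mix r i j ≈ N i j
    mix-≤ r i j r≤j with r ℕ.≤? toℕ j
    ... | yes _  = refl
    ... | no r≰j = contradiction r≤j r≰j

    mix-> : ∀ r i j → toℕ j ℕ.< r → mix r i j ≈ M i j
    mix-> r i j j<r with r ℕ.≤? toℕ j
    ... | yes r≤j = contradiction r≤j (ℕ.<⇒≱ j<r)
    ... | no _    = refl

    step : ∀ r → r ℕ.< n → det (mix r) ≈ det (mix (suc r))
    step r r<n = det-combination (mix (suc r)) (mix r) k (λ m → U m k) (Uⱼⱼ≈1 k) at off
      where
      k : Fin n
      k = fromℕ< r<n
      toℕk≡r : toℕ k ≡ r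
      toℕk≡r = Fin.toℕ-fromℕ< r<n
      entry : ∀ i m → U m k * M i m ≈ U m k * mix (suc r) i m
      entry i m with ℕ.<-≤-connex r (toℕ m)
      ... | inj₁ r<m = trans (*-congʳ U≈0′) (trans (zeroˡ _) (sym (trans (*-congʳ U≈0′) (zeroˡ _))))
        where U≈0′ = U≈0 m k (≡.subst (ℕ._< toℕ m) (≡.sym toℕk≡r) r<m)
      ... | inj₂ m≤r = *-congˡ (sym (mix-> (suc r) i m (s≤s m≤r)))
      at : ∀ i → mix r i k ≈ sum λ m → U m k * mix (suc r) i m
      at i = trans (mix-≤ r i k (ℕ.≤-reflexive (≡.sym toℕk≡r))) (trans (N≈MU i k) (sum-cong-≋ (entry i)))
      off : ∀ i j → j ≢ k → mix r i j ≈ mix (suc r) i j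
      off i j j≢k with ℕ.<-cmp r (toℕ j)
      ... | tri< r<j _ _ = trans (mix-≤ r i j (ℕ.<⇒≤ r<j)) (sym (mix-≤ (suc r) i j r<j))
      ... | tri≈ _ r≡j _ = contradiction (Fin.toℕ-injective (≡.trans (≡.sym r≡j) (≡.sym toℕk≡r))) j≢k
      ... | tri> _ _ j<r = trans (mix-> r i j j<r) (sym (mix-> (suc r) i j (ℕ.m<n⇒m<1+n j<r)))

    sweep : ∀ r → r ≤ n → det (mix 0) ≈ det (mix r)
    sweep zero    _   = refl
    sweep (suc r) r<n = trans (sweep r (ℕ.<⇒≤ r<n)) (step r r<n)

  det-lowerTriangular : ∀ {n} (M : Matrix n) → (∀ i j → toℕ i ℕ.< toℕ j → M i j ≈ 0#) →
    det M ≈ product λ i → M i i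
  det-lowerTriangular {zero}  M M≈0 = refl
  det-lowerTriangular {suc n} M M≈0 = begin
    sum (term M)                    ≈⟨ sum-single (term M) zero offDiagonal ⟩
    1# * M zero zero * det (minor M zero) ≈⟨ *-cong (*-identityˡ _) (det-lowerTriangular (minor M zero) λ i j i<j → M≈0 (suc i) (suc j) (s≤s i<j)) ⟩
    M zero zero * product (λ i → M (suc i) (suc i)) ∎
    where
    offDiagonal : ∀ j → j ≢ zero → term M j ≈ 0#
    offDiagonal zero    0≢0 = contradiction ≡.refl 0≢0
    offDiagonal (suc j) _   = trans (*-congʳ (trans (*-congˡ (M≈0 zero (suc j) (s≤s z≤n))) (zeroʳ _))) (zeroˡ _)

-- Hankel determinants of S-fractions

-- Recursive, so that `double (suc i)` computes to two successors: the recursions along the fraction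
-- advance its index by two.
double : ℕ → ℕ
double zero    = zero
double (suc i) = suc (suc (double i))

double≡+ : ∀ i → double i ≡ i ℕ.+ i
double≡+ zero    = ≡.refl
double≡+ (suc i) = ≡.cong suc (≡.trans (≡.cong suc (double≡+ i)) (≡.sym (ℕ.+-suc i i)))

-- Power series as coefficient sequences

module Series {c ℓ} (R : CommutativeRing c ℓ) where
  open CommutativeRing R hiding (zero)
  open import Algebra.Solver.Ring.NaturalCoefficients.Default commutativeSemiring
    using (solve; _:=_; _:+_; _:*_)
  open import Relation.Binary.Reasoning.Setoid setoid

  infixl 7 _⊛_
  -- The Cauchy product.
  _⊛_ : (ℕ → Carrier) → (ℕ → Carrier) → ℕ → Carrier
  (f ⊛ g) zero    = f 0 * g 0
  (f ⊛ g) (suc j) = f 0 * g (suc j) + ((f ∘ suc) ⊛ g) j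

  ⊛-cong : ∀ {f f′ g g′ : ℕ → Carrier} → (∀ i → f i ≈ f′ i) → (∀ i → g i ≈ g′ i) → ∀ j → (f ⊛ g) j ≈ (f′ ⊛ g′) j
  ⊛-cong f≈f′ g≈g′ zero    = *-cong (f≈f′ 0) (g≈g′ 0)
  ⊛-cong f≈f′ g≈g′ (suc j) = +-cong (*-cong (f≈f′ 0) (g≈g′ (suc j))) (⊛-cong (f≈f′ ∘ suc) g≈g′ j)

  0-⊛ : ∀ g j → (const 0# ⊛ g) j ≈ 0#
  0-⊛ g zero    = zeroˡ _
  0-⊛ g (suc j) = trans (+-cong (zeroˡ _) (0-⊛ g j)) (+-identityˡ 0#)

  ⊛-linearˡ : ∀ a (f f′ g : ℕ → Carrier) j → ((λ i → a * f i + f′ i) ⊛ g) j ≈ a * (f ⊛ g) j + (f′ ⊛ g) j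
  ⊛-linearˡ a f f′ g zero    = solve 4 (λ a x y z → (a :* x :+ y) :* z := a :* (x :* z) :+ y :* z) refl a (f 0) (f′ 0) (g 0)
  ⊛-linearˡ a f f′ g (suc j) = begin
    (a * f 0 + f′ 0) * g (suc j) + ((λ i → a * f (suc i) + f′ (suc i)) ⊛ g) j  ≈⟨ +-congˡ (⊛-linearˡ a (f ∘ suc) (f′ ∘ suc) g j) ⟩
    (a * f 0 + f′ 0) * g (suc j) + (a * ((f ∘ suc) ⊛ g) j + ((f′ ∘ suc) ⊛ g) j)
      ≈⟨ solve 6 (λ a x y z p q → (a :* x :+ y) :* z :+ (a :* p :+ q) := a :* (x :* z :+ p) :+ (y :* z :+ q)) refl a (f 0) (f′ 0) (g (suc j)) (((f ∘ suc) ⊛ g) j) (((f′ ∘ suc) ⊛ g) j) ⟩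
    a * (f ⊛ g) (suc j) + (f′ ⊛ g) (suc j)                                     ∎

  ⊛-tail : ∀ (f g : ℕ → Carrier) → f 0 ≈ 0# → ∀ j → ((f ∘ suc) ⊛ g) j ≈ (f ⊛ g) (suc j)
  ⊛-tail f g f₀≈0 j = sym (trans (+-congʳ (trans (*-congʳ f₀≈0) (zeroˡ _))) (+-identityˡ _))

  -- A series with constant term 1 is a unit, so multiplying by it changes neither order nor leading
  -- coefficient. This replaces division by `g`.
  ⊛-lowOrder : ∀ {f g : ℕ → Carrier} → g 0 ≈ 1# → ∀ i → (∀ j → j ℕ.< i → (f ⊛ g) j ≈ 0#) →
    (∀ j → j ℕ.< i → f j ≈ 0#) × f i ≈ (f ⊛ g) i
  ⊛-lowOrder {f} {g} g₀≈1 zero    _   = (λ _ ()) , sym (trans (*-congˡ g₀≈1) (*-identityʳ _))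
  ⊛-lowOrder {f} {g} g₀≈1 (suc i) fg≈0 = below , trans (proj₂ rest) (⊛-tail f g f₀≈0 i)
    where
    f₀≈0 : f 0 ≈ 0#
    f₀≈0 = trans (sym (trans (*-congˡ g₀≈1) (*-identityʳ _))) (fg≈0 0 (s≤s z≤n))
    rest = ⊛-lowOrder {f ∘ suc} g₀≈1 i λ j j<i → trans (⊛-tail f g f₀≈0 j) (fg≈0 (suc j) (s≤s j<i))
    below : ∀ j → j ℕ.< suc i → f j ≈ 0#
    below zero    _         = f₀≈0
    below (suc j) (s≤s j<i) = proj₁ rest j j<i

-- An S-fraction for the generating series s = ν H₁ / H₀, given by power series
-- H₀, H₁, H₂, … with constant term 1 and Hₖ = Hₖ₊₁ + cₖ z Hₖ₊₂ up to order T.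
module SFraction {c ℓ} (R : CommutativeRing c ℓ) where
  open CommutativeRing R hiding (zero)
  open import Algebra.Definitions.RawSemiring (Semiring.rawSemiring semiring) using (product)
  open import Algebra.Properties.Group +-group using (identityʳ-unique)
  open import Algebra.Properties.Monoid.Sum *-monoid using () renaming (sum-cong-≋ to product-cong)
  open import Algebra.Properties.Semiring.Sum semiring
    using (sum; sum-cong-≋; ∑-distrib-+; *-distribˡ-sum; sum-init-last)
  open import Algebra.Solver.Ring.NaturalCoefficients.Default commutativeSemiring
    using (solve; _:=_; _:+_; _:*_)
  open import Relation.Binary.Reasoning.Setoid setoid
  open Det rawRing using (det)
  open Determinant R
  open Series R

  pivot : Carrier → (ℕ → Carrier) → ℕ → Carrier
  pivot ν c zero    = ν
  pivot ν c (suc i) = pivot ν c i * c (double i) * c (suc (double i))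

  module Elimination (s c : ℕ → Carrier) where
    -- For the S-fraction of s these are h zⁱ H₂ᵢ₊₁ / H₀ and − h c₂ᵢ zⁱ H₂ᵢ₊₂ / H₀,
    -- where h = pivot ν c i.
    evenStep oddStep : ℕ → ℕ → Carrier
    evenStep zero    j = s j
    evenStep (suc i) j = c (double i) * evenStep i j + oddStep i j
    oddStep zero    j = s (suc j)
    oddStep (suc i) j = c (suc (double i)) * oddStep i j + evenStep (suc i) (suc j)

    shift : (ℕ → Carrier) → ℕ → Carrier
    shift p zero    = 0#
    shift p (suc m) = p m

    -- The recursions of `evenStep` and `oddStep`, with multiplication by x (`shift`) in place of
    -- dropping the first term. For the functional xᵐ ↦ `s m` of an S-fraction with nonzero pivots,
    -- `evenPoly i` is the monic orthogonal polynomial of degree i, and `oddPoly i` is x times the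
    -- one for the shifted functional xᵐ ↦ `s (suc m)`.
    evenPoly oddPoly : ℕ → ℕ → Carrier
    evenPoly zero    zero    = 1#
    evenPoly zero    (suc m) = 0#
    evenPoly (suc i) m = c (double i) * evenPoly i m + oddPoly i m
    oddPoly zero    m = shift (evenPoly zero) m
    oddPoly (suc i) m = c (suc (double i)) * oddPoly i m + shift (evenPoly (suc i)) m

    evenPoly-degree : ∀ i m → i ℕ.< m → evenPoly i m ≈ 0#
    oddPoly-degree : ∀ i m → suc i ℕ.< m → oddPoly i m ≈ 0#
    evenPoly-degree zero    (suc m) _     = refl
    evenPoly-degree (suc i) m       i+1<m =
      trans (+-cong (trans (*-congˡ (evenPoly-degree i m (ℕ.<-trans (ℕ.n<1+n i) i+1<m))) (zeroʳ _)) (oddPoly-degree i m i+1<m)) (+-identityˡ 0#)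
    oddPoly-degree zero    (suc m) (s≤s 0<m) = evenPoly-degree 0 m 0<m
    oddPoly-degree (suc i) (suc m) (s≤s i<m) =
      trans (+-cong (trans (*-congˡ (oddPoly-degree i (suc m) (s≤s (ℕ.<-trans (ℕ.n<1+n i) i<m)))) (zeroʳ _)) (evenPoly-degree (suc i) m i<m)) (+-identityˡ 0#)

    evenPoly-monic : ∀ i → evenPoly i i ≈ 1#
    oddPoly-monic : ∀ i → oddPoly i (suc i) ≈ 1#
    evenPoly-monic zero    = refl
    evenPoly-monic (suc i) =
      trans (+-cong (trans (*-congˡ (evenPoly-degree i (suc i) (ℕ.n<1+n i))) (zeroʳ _)) (oddPoly-monic i)) (+-identityˡ 1#)
    oddPoly-monic zero    = refl
    oddPoly-monic (suc i) =
      trans (+-cong (trans (*-congˡ (oddPoly-degree i (suc (suc i)) ℕ.≤-refl)) (zeroʳ _)) (evenPoly-monic (suc i))) (+-identityˡ 1#)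

    -- The functional xᵐ ↦ `s m` applied to xʲ p, cut off after `t` coefficients of p so as to be a
    -- combination of the columns of a matrix of size `t`.
    pairing : ℕ → (ℕ → Carrier) → ℕ → Carrier
    pairing t p j = sum {t} λ m → p (toℕ m) * s (toℕ m ℕ.+ j)

    pairing-linear : ∀ t a p q j → pairing t (λ m → a * p m + q m) j ≈ a * pairing t p j + pairing t q j
    pairing-linear t a p q j = begin
      sum {t} (λ m → (a * p (toℕ m) + q (toℕ m)) * s (toℕ m ℕ.+ j))
        ≈⟨ sum-cong-≋ {t} (λ m → solve 4 (λ a p q s → (a :* p :+ q) :* s := a :* (p :* s) :+ q :* s) refl a (p (toℕ m)) (q (toℕ m)) (s (toℕ m ℕ.+ j))) ⟩
      sum {t} (λ m → a * (p (toℕ m) * s (toℕ m ℕ.+ j)) + q (toℕ m) * s (toℕ m ℕ.+ j))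
        ≈⟨ ∑-distrib-+ {t} (λ m → a * (p (toℕ m) * s (toℕ m ℕ.+ j))) (λ m → q (toℕ m) * s (toℕ m ℕ.+ j)) ⟩
      sum {t} (λ m → a * (p (toℕ m) * s (toℕ m ℕ.+ j))) + pairing t q j
        ≈⟨ +-congʳ (*-distribˡ-sum {t} a (λ m → p (toℕ m) * s (toℕ m ℕ.+ j))) ⟨
      a * pairing t p j + pairing t q j ∎

    -- Multiplication by x moves to the argument of `s`. The top coefficient must vanish because the
    -- cut-off would lose it on one side only.
    pairing-shift : ∀ t p j → p t ≈ 0# → pairing (suc t) (shift p) j ≈ pairing (suc t) p (suc j)
    pairing-shift t p j pₜ≈0 = begin
      0# * s j + sum {t} (λ m → p (toℕ m) * s (suc (toℕ m) ℕ.+ j))   ≈⟨ +-congʳ (zeroˡ _) ⟩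
      0# + sum {t} (λ m → p (toℕ m) * s (suc (toℕ m) ℕ.+ j))         ≈⟨ +-comm _ _ ⟩
      sum {t} (λ m → p (toℕ m) * s (suc (toℕ m) ℕ.+ j)) + 0#
        ≈⟨ +-cong (sum-cong-≋ {t} λ m → reflexive (≡.cong₂ (λ a b → p a * s b) (≡.sym (Fin.toℕ-inject₁ m))
             (≡.trans (≡.sym (ℕ.+-suc (toℕ m) j)) (≡.cong (ℕ._+ suc j) (≡.sym (Fin.toℕ-inject₁ m))))))
             (sym (trans (*-congʳ (trans (reflexive (≡.cong p (Fin.toℕ-fromℕ t))) pₜ≈0)) (zeroˡ _))) ⟩
      sum {t} (λ m → g (inject₁ m)) + g (Fin.fromℕ t)                    ≈⟨ sum-init-last g ⟨
      pairing (suc t) p (suc j)                                      ∎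
      where
      g : Fin (suc t) → Carrier
      g m = p (toℕ m) * s (toℕ m ℕ.+ suc j)

    -- The bounds on `i` say that the polynomials, of degrees `i` and `suc i`, fit into `suc t`
    -- coefficients.
    evenStep-pairing : ∀ t i j → i ≤ t → evenStep i j ≈ pairing (suc t) (evenPoly i) j
    oddStep-pairing : ∀ t i j → i ℕ.< t → oddStep i j ≈ pairing (suc t) (oddPoly i) j
    evenStep-pairing t zero j _ = sym (trans (sum-single {suc t} (λ m → evenPoly zero (toℕ m) * s (toℕ m ℕ.+ j)) zero
      λ { zero 0≢0 → contradiction ≡.refl 0≢0 ; (suc m) _ → zeroˡ _ }) (*-identityˡ _))
    evenStep-pairing t (suc i) j i<t = trans
      (+-cong (*-congˡ (evenStep-pairing t i j (ℕ.<⇒≤ i<t))) (oddStep-pairing t i j i<t))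
      (sym (pairing-linear (suc t) (c (double i)) (evenPoly i) (oddPoly i) j))
    oddStep-pairing t zero j 0<t = trans (evenStep-pairing t zero (suc j) z≤n)
      (sym (pairing-shift t (evenPoly zero) j (evenPoly-degree zero t 0<t)))
    oddStep-pairing t (suc i) j i+1<t = trans
      (+-cong (*-congˡ (oddStep-pairing t i j (ℕ.<⇒≤ i+1<t))) (trans (evenStep-pairing t (suc i) (suc j) (ℕ.<⇒≤ i+1<t))
        (sym (pairing-shift t (evenPoly (suc i)) j (evenPoly-degree (suc i) t i+1<t)))))
      (sym (pairing-linear (suc t) (c (suc (double i))) (oddPoly i) (shift (evenPoly (suc i))) j))

    det-hankel : ∀ t → det {suc t} (λ i j → s (toℕ i ℕ.+ toℕ j)) ≈ det {suc t} (λ i j → evenStep (toℕ j) (toℕ i))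
    det-hankel t = sym (det-unitriangular (λ i j → s (toℕ i ℕ.+ toℕ j)) (λ i j → evenStep (toℕ j) (toℕ i))
      (λ m j → evenPoly (toℕ j) (toℕ m)) (λ j → evenPoly-monic (toℕ j)) (λ m j → evenPoly-degree (toℕ j) (toℕ m))
      λ i j → trans (evenStep-pairing t (toℕ j) (toℕ i) (ℕ.s≤s⁻¹ (Fin.toℕ<n j)))
        (sum-cong-≋ {suc t} λ m → *-congˡ {evenPoly (toℕ j) (toℕ m)} (reflexive (≡.cong s (ℕ.+-comm (toℕ m) (toℕ i))))))

  module _ (T : ℕ) (ν : Carrier) (s c : ℕ → Carrier) (H : ℕ → ℕ → Carrier)
    (H₀≈1 : ∀ k → H k 0 ≈ 1#)
    -- The bound weighs index and order together: each step along the fraction costs one order of z,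
    -- so later series are constrained to fewer coefficients.
    (H-step : ∀ k j → k ℕ.+ j ℕ.< T → H k (suc j) ≈ H (suc k) (suc j) + c k * H (suc (suc k)) j)
    (s⊛H : ∀ j → (s ⊛ H 0) j ≈ ν * H 1 j) where
    open Elimination s c

    -- With the constant term zero, dropping it is division by z, as the odd steps require.
    head-zero : ∀ {f : ℕ → Carrier} i → (∀ j → j ℕ.< suc i → (f ⊛ H 0) j ≈ 0#) → f 0 ≈ 0#
    head-zero i below = proj₁ (⊛-lowOrder (H₀≈1 0) (suc i) below) 0 (s≤s z≤n)

    private
      h : ℕ → Carrier
      h = pivot ν c

    -- The formula for `evenStep i` multiplied by H₀, namely h zⁱ H₂ᵢ₊₁, separated into the orders
    -- below i and those from i on. The premises keep to the range where `H-step` is available.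
    record EvenSeries (i : ℕ) : Set ℓ where
      field
        below : double i ≤ T → ∀ j → j ℕ.< i → (evenStep i ⊛ H 0) j ≈ 0#
        value : ∀ k → double i ℕ.+ k ≤ T → (evenStep i ⊛ H 0) (i ℕ.+ k) ≈ h i * H (suc (double i)) k

    -- The odd counterpart, with the negative term brought to the left so that the semiring solver
    -- can treat it.
    record OddSeries (i : ℕ) : Set ℓ where
      field
        below : suc (double i) ≤ T → ∀ j → j ℕ.< i → (oddStep i ⊛ H 0) j ≈ 0#
        value : ∀ k → suc (double i) ℕ.+ k ≤ T →
          (oddStep i ⊛ H 0) (i ℕ.+ k) + h i * c (double i) * H (suc (suc (double i))) k ≈ 0#

    open EvenSeries
    open OddSeries

    evenSeries-zero : EvenSeries 0
    evenSeries-zero .below _ _ ()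
    evenSeries-zero .value k _ = s⊛H k

    evenSeries-suc : ∀ i → EvenSeries i → OddSeries i → EvenSeries (suc i)
    evenSeries-suc i E O = record { below = below-suc ; value = value-suc }
      where
      below-suc : double (suc i) ≤ T → ∀ j → j ℕ.< suc i → (evenStep (suc i) ⊛ H 0) j ≈ 0#
      below-suc i≤T j j<1+i = begin
        (evenStep (suc i) ⊛ H 0) j                                    ≈⟨ ⊛-linearˡ cᵢ (evenStep i) (oddStep i) (H 0) j ⟩
        cᵢ * (evenStep i ⊛ H 0) j + (oddStep i ⊛ H 0) j               ≈⟨ vanishes (ℕ.m≤n⇒m<n∨m≡n (ℕ.s≤s⁻¹ j<1+i)) ⟩
        0#                                                            ∎
        where
        cᵢ = c (double i)
        vanishes : j ℕ.< i ⊎ j ≡ i → cᵢ * (evenStep i ⊛ H 0) j + (oddStep i ⊛ H 0) j ≈ 0#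
        vanishes (inj₁ j<i) = trans (+-cong (trans (*-congˡ (below E (ℕ.<⇒≤ (ℕ.<⇒≤ i≤T)) j j<i)) (zeroʳ _)) (below O (ℕ.<⇒≤ i≤T) j j<i)) (+-identityˡ 0#)
        -- At order exactly i the two leading terms cancel because `H (suc (double i))` and
        -- `H (suc (suc (double i)))` both start with 1.
        vanishes (inj₂ ≡.refl) = begin
          cᵢ * (evenStep i ⊛ H 0) i + o                              ≈⟨ +-congʳ (*-congˡ (reflexive (≡.cong (evenStep i ⊛ H 0) (ℕ.+-identityʳ i)))) ⟨
          cᵢ * (evenStep i ⊛ H 0) (i ℕ.+ 0) + o                      ≈⟨ +-congʳ (*-congˡ (value E 0 (≡.subst (_≤ T) (≡.sym (ℕ.+-identityʳ _)) (ℕ.<⇒≤ (ℕ.<⇒≤ i≤T))))) ⟩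
          cᵢ * (h i * H (suc (double i)) 0) + o                      ≈⟨ +-congʳ (*-congˡ (*-congˡ (trans (H₀≈1 _) (sym (H₀≈1 _))))) ⟩
          cᵢ * (h i * H (suc (suc (double i))) 0) + o                ≈⟨ solve 4 (λ c h x o → c :* (h :* x) :+ o := o :+ h :* c :* x) refl cᵢ (h i) (H (suc (suc (double i))) 0) o ⟩
          o + h i * cᵢ * H (suc (suc (double i))) 0                  ≈⟨ +-congʳ (reflexive (≡.cong (oddStep i ⊛ H 0) (ℕ.+-identityʳ i))) ⟨
          (oddStep i ⊛ H 0) (i ℕ.+ 0) + h i * cᵢ * H (suc (suc (double i))) 0  ≈⟨ value O 0 (≡.subst (_≤ T) (≡.sym (ℕ.+-identityʳ _)) (ℕ.<⇒≤ i≤T)) ⟩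
          0#                                                         ∎
          where o = (oddStep i ⊛ H 0) i

      value-suc : ∀ k → double (suc i) ℕ.+ k ≤ T → (evenStep (suc i) ⊛ H 0) (suc i ℕ.+ k) ≈ h (suc i) * H (suc (double (suc i))) k
      value-suc k i+k≤T = begin
        (evenStep (suc i) ⊛ H 0) (suc (i ℕ.+ k))                        ≡⟨ ≡.cong (evenStep (suc i) ⊛ H 0) (≡.sym (ℕ.+-suc i k)) ⟩
        (evenStep (suc i) ⊛ H 0) (i ℕ.+ suc k)                          ≈⟨ ⊛-linearˡ a (evenStep i) (oddStep i) (H 0) (i ℕ.+ suc k) ⟩
        a * (evenStep i ⊛ H 0) (i ℕ.+ suc k) + o                        ≈⟨ +-congʳ (*-congˡ (value E (suc k) (≡.subst (_≤ T) (≡.sym (ℕ.+-suc (double i) k)) (ℕ.<⇒≤ i+k≤T)))) ⟩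
        -- One step of the fraction splits this series; its first part cancels against the odd
        -- series and the second carries the new pivot.
        a * (h i * H (suc (double i)) (suc k)) + o                      ≈⟨ +-congʳ (*-congˡ (*-congˡ (H-step (suc (double i)) k i+k≤T))) ⟩
        a * (h i * (x + b * y)) + o                                     ≈⟨ solve 6 (λ a b h x y o → a :* (h :* (x :+ b :* y)) :+ o := h :* a :* b :* y :+ (o :+ h :* a :* x)) refl a b (h i) x y o ⟩
        h i * a * b * y + (o + h i * a * x)                             ≈⟨ +-congˡ (value O (suc k) (≡.subst (_≤ T) (≡.sym (ℕ.+-suc (suc (double i)) k)) i+k≤T)) ⟩
        h i * a * b * y + 0#                                            ≈⟨ +-identityʳ _ ⟩
        h (suc i) * H (suc (double (suc i))) k                          ∎
        where
        a = c (double i)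
        b = c (suc (double i))
        o = (oddStep i ⊛ H 0) (i ℕ.+ suc k)
        x = H (suc (suc (double i))) (suc k)
        y = H (suc (suc (suc (double i)))) k

    oddSeries-zero : OddSeries 0
    oddSeries-zero = record { below = λ _ _ () ; value = value-zero }
      where
      value-zero : ∀ k → 1 ℕ.+ k ≤ T → (oddStep 0 ⊛ H 0) k + ν * c 0 * H 2 k ≈ 0#
      -- Adding ν H₁ at order k + 1 turns the claim into the relation s H₀ = ν H₁ at that order, so
      -- uniqueness of the neutral element does the subtraction.
      value-zero k k<T = identityʳ-unique (ν * x) _ (begin
        ν * x + (e + ν * c 0 * y)        ≈⟨ solve 5 (λ n x e c y → n :* x :+ (e :+ n :* c :* y) := n :* (x :+ c :* y) :+ e) refl ν x e (c 0) y ⟩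
        ν * (x + c 0 * y) + e            ≈⟨ +-congʳ (*-cong s₀≈ν (H-step 0 k k<T)) ⟨
        s 0 * H 0 (suc k) + e            ≈⟨ s⊛H (suc k) ⟩
        ν * x                            ∎)
        where
        x = H 1 (suc k)
        y = H 2 k
        e = ((s ∘ suc) ⊛ H 0) k
        s₀≈ν : s 0 ≈ ν
        s₀≈ν = begin
          s 0          ≈⟨ *-identityʳ _ ⟨
          s 0 * 1#     ≈⟨ *-congˡ (H₀≈1 0) ⟨
          s 0 * H 0 0  ≈⟨ s⊛H 0 ⟩
          ν * H 1 0    ≈⟨ *-congˡ (H₀≈1 1) ⟩
          ν * 1#       ≈⟨ *-identityʳ ν ⟩
          ν            ∎
    oddSeries-suc : ∀ i → OddSeries i → EvenSeries (suc i) → OddSeries (suc i)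
    oddSeries-suc i O E = record { below = below-suc ; value = value-suc }
      where
      below-suc : suc (double (suc i)) ≤ T → ∀ j → j ℕ.< suc i → (oddStep (suc i) ⊛ H 0) j ≈ 0#
      below-suc i<T j j<1+i = begin
        (oddStep (suc i) ⊛ H 0) j                                   ≈⟨ ⊛-linearˡ b (oddStep i) (evenStep (suc i) ∘ suc) (H 0) j ⟩
        b * (oddStep i ⊛ H 0) j + ((evenStep (suc i) ∘ suc) ⊛ H 0) j ≈⟨ +-congˡ (⊛-tail (evenStep (suc i)) (H 0) (head-zero i (below E i≤T)) j) ⟩
        b * (oddStep i ⊛ H 0) j + (evenStep (suc i) ⊛ H 0) (suc j)  ≈⟨ vanishes (ℕ.m≤n⇒m<n∨m≡n (ℕ.s≤s⁻¹ j<1+i)) ⟩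
        0#                                                          ∎
        where
        i≤T = ℕ.<⇒≤ i<T
        a = c (double i)
        b = c (suc (double i))
        vanishes : j ℕ.< i ⊎ j ≡ i → b * (oddStep i ⊛ H 0) j + (evenStep (suc i) ⊛ H 0) (suc j) ≈ 0#
        vanishes (inj₁ j<i) = trans (+-cong (trans (*-congˡ (below O (ℕ.<⇒≤ i≤T) j j<i)) (zeroʳ _)) (below E i≤T (suc j) (s≤s j<i))) (+-identityˡ 0#)
        vanishes (inj₂ ≡.refl) = begin
          b * o + (evenStep (suc i) ⊛ H 0) (suc i)                        ≈⟨ +-cong (*-congˡ (reflexive (≡.cong (oddStep i ⊛ H 0) (ℕ.+-identityʳ i)))) (reflexive (≡.cong (evenStep (suc i) ⊛ H 0) (ℕ.+-identityʳ (suc i)))) ⟨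
          b * o′ + (evenStep (suc i) ⊛ H 0) (suc (i ℕ.+ 0))               ≈⟨ +-congˡ (value E 0 (≡.subst (_≤ T) (≡.sym (ℕ.+-identityʳ _)) i≤T)) ⟩
          b * o′ + h i * a * b * H (suc (double (suc i))) 0               ≈⟨ +-congˡ (*-congˡ (trans (H₀≈1 _) (sym (H₀≈1 _)))) ⟩
          b * o′ + h i * a * b * x                                        ≈⟨ solve 5 (λ a b h x o → b :* o :+ h :* a :* b :* x := b :* (o :+ h :* a :* x)) refl a b (h i) x o′ ⟩
          b * (o′ + h i * a * x)                                          ≈⟨ *-congˡ (value O 0 (≡.subst (_≤ T) (≡.sym (ℕ.+-identityʳ _)) (ℕ.<⇒≤ i≤T))) ⟩
          b * 0#                                                          ≈⟨ zeroʳ b ⟩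
          0#                                                              ∎
          where
          o = (oddStep i ⊛ H 0) i
          o′ = (oddStep i ⊛ H 0) (i ℕ.+ 0)
          x = H (suc (suc (double i))) 0

      value-suc : ∀ k → suc (double (suc i)) ℕ.+ k ≤ T →
        (oddStep (suc i) ⊛ H 0) (suc i ℕ.+ k) + h (suc i) * c (double (suc i)) * H (suc (suc (double (suc i)))) k ≈ 0#
      value-suc k i+k<T = begin
        (oddStep (suc i) ⊛ H 0) (suc i ℕ.+ k) + w
          ≈⟨ +-congʳ (⊛-linearˡ b (oddStep i) (evenStep (suc i) ∘ suc) (H 0) (suc i ℕ.+ k)) ⟩
        b * (oddStep i ⊛ H 0) (suc i ℕ.+ k) + ((evenStep (suc i) ∘ suc) ⊛ H 0) (suc i ℕ.+ k) + w
          ≈⟨ +-congʳ (+-cong (*-congˡ (reflexive (≡.cong (oddStep i ⊛ H 0) (≡.sym (ℕ.+-suc i k))))) (⊛-tail (evenStep (suc i)) (H 0) (head-zero i (below E (ℕ.≤-trans (ℕ.m≤m+n _ k) (ℕ.<⇒≤ i+k<T)))) (suc i ℕ.+ k))) ⟩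
        b * o + (evenStep (suc i) ⊛ H 0) (suc (suc i ℕ.+ k)) + w
          ≈⟨ +-congʳ (+-congˡ (trans (reflexive (≡.cong (evenStep (suc i) ⊛ H 0) (≡.sym (ℕ.+-suc (suc i) k)))) (value E (suc k) (≡.subst (_≤ T) (≡.sym (ℕ.+-suc (double (suc i)) k)) i+k<T)))) ⟩
        b * o + h i * a * b * x + h i * a * b * d * y
          ≈⟨ solve 7 (λ a b d h x y o → b :* o :+ h :* a :* b :* x :+ h :* a :* b :* d :* y := b :* (o :+ h :* a :* (x :+ d :* y))) refl a b d (h i) x y o ⟩
        b * (o + h i * a * (x + d * y))
          ≈⟨ *-congˡ (+-congˡ (*-congˡ (H-step (double (suc i)) k i+k<T))) ⟨
        b * (o + h i * a * H (suc (suc (double i))) (suc k))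
          ≈⟨ *-congˡ (value O (suc k) (≡.subst (_≤ T) (≡.sym (ℕ.+-suc (suc (double i)) k)) (ℕ.<⇒≤ i+k<T))) ⟩
        b * 0#  ≈⟨ zeroʳ b ⟩
        0#      ∎
        where
        a = c (double i)
        b = c (suc (double i))
        d = c (double (suc i))
        o = (oddStep i ⊛ H 0) (i ℕ.+ suc k)
        x = H (suc (double (suc i))) (suc k)
        y = H (suc (suc (double (suc i)))) k
        w = h (suc i) * d * y

    series : ∀ i → EvenSeries i × OddSeries i
    series zero    = evenSeries-zero , oddSeries-zero
    series (suc i) with E , O ← series i = E′ , oddSeries-suc i O E′
      where E′ = evenSeries-suc i E O

    -- By `⊛-lowOrder`, column j after elimination starts in row j with entry `h j`, so the matrix
    -- is lower triangular. The last column needs the series up to order `double t`, which is why T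
    -- has this value.
    hankel-product : ∀ t → T ≡ double t → det {suc t} (λ i j → s (toℕ i ℕ.+ toℕ j)) ≈ product {suc t} λ i → h (toℕ i)
    hankel-product t ≡.refl = trans (det-hankel t) (trans (det-lowerTriangular {suc t} (λ i j → evenStep (toℕ j) (toℕ i)) λ i j → proj₁ (low j) (toℕ i))
      (product-cong {suc t} λ i → trans (proj₂ (low i)) (trans (reflexive (≡.cong (evenStep (toℕ i) ⊛ H 0) (≡.sym (ℕ.+-identityʳ (toℕ i)))))
        (trans (value (even i) 0 (≡.subst (_≤ double t) (≡.sym (ℕ.+-identityʳ _)) (bound i))) (trans (*-congˡ (H₀≈1 _)) (*-identityʳ _))))))
      where
      double-mono : ∀ {i j} → i ≤ j → double i ≤ double j
      double-mono z≤n       = z≤n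
      double-mono (s≤s i≤j) = s≤s (s≤s (double-mono i≤j))
      bound : ∀ i → double (toℕ {suc t} i) ≤ double t
      bound i = double-mono (ℕ.s≤s⁻¹ (Fin.toℕ<n i))
      even : ∀ (i : Fin (suc t)) → EvenSeries (toℕ i)
      even i = proj₁ (series (toℕ i))
      low : ∀ (i : Fin (suc t)) → _
      low i = ⊛-lowOrder {evenStep (toℕ i)} (H₀≈1 0) (toℕ i) (below (even i) (bound i))

-- Newton's identities

module Roots {c ℓ} (R : CommutativeRing c ℓ) where
  open CommutativeRing R hiding (zero)
  open RawSemiringDefs (Semiring.rawSemiring semiring) using (_^_; sum) renaming (_×_ to _·_)
  open import Algebra.Solver.Ring.NaturalCoefficients.Default commutativeSemiring
    using (solve; _:=_; _:+_; _:*_; con)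
  open import Relation.Binary.Reasoning.Setoid setoid
  open Poly rawRing
  open Series R

  coeff-+ₚ : ∀ p q k → coeff (p +ₚ q) k ≈ coeff p k + coeff q k
  coeff-+ₚ []      q       k       = sym (+-identityˡ _)
  coeff-+ₚ (a ∷ p) []      k       = sym (+-identityʳ _)
  coeff-+ₚ (a ∷ p) (b ∷ q) zero    = refl
  coeff-+ₚ (a ∷ p) (b ∷ q) (suc k) = coeff-+ₚ p q k

  coeff-·ₚ : ∀ a p k → coeff (a ·ₚ p) k ≈ a * coeff p k
  coeff-·ₚ a []      k       = sym (zeroʳ a)
  coeff-·ₚ a (b ∷ p) zero    = refl
  coeff-·ₚ a (b ∷ p) (suc k) = coeff-·ₚ a p k

  coeff-X-*ₚ-zero : ∀ a q → coeff ((X- a) *ₚ q) 0 ≈ - a * coeff q 0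
  coeff-X-*ₚ-zero a q = trans (coeff-+ₚ (- a ·ₚ q) _ 0) (trans (+-identityʳ _) (coeff-·ₚ (- a) q 0))

  coeff-X-*ₚ-suc : ∀ a q k → coeff ((X- a) *ₚ q) (suc k) ≈ coeff q k + - a * coeff q (suc k)
  coeff-X-*ₚ-suc a q k = begin
    coeff ((X- a) *ₚ q) (suc k)                                     ≈⟨ coeff-+ₚ (- a ·ₚ q) (0# ∷ (1# ·ₚ q +ₚ (0# ∷ []))) (suc k) ⟩
    coeff (- a ·ₚ q) (suc k) + coeff (1# ·ₚ q +ₚ (0# ∷ [])) k       ≈⟨ +-cong (coeff-·ₚ (- a) q (suc k)) (coeff-+ₚ (1# ·ₚ q) (0# ∷ []) k) ⟩
    - a * coeff q (suc k) + (coeff (1# ·ₚ q) k + coeff (0# ∷ []) k) ≈⟨ +-congˡ (+-cong (trans (coeff-·ₚ 1# q k) (*-identityˡ _)) (coeff-0∷[] k)) ⟩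
    - a * coeff q (suc k) + (coeff q k + 0#)                        ≈⟨ +-congˡ (+-identityʳ _) ⟩
    - a * coeff q (suc k) + coeff q k                               ≈⟨ +-comm _ _ ⟩
    coeff q k + - a * coeff q (suc k)                               ∎
    where
    coeff-0∷[] : ∀ k → coeff (0# ∷ []) k ≈ 0#
    coeff-0∷[] zero    = refl
    coeff-0∷[] (suc k) = refl

  -- ∏ (1 − θᵢ z)
  reversed : ∀ {n} → (Fin n → Carrier) → ℕ → Carrier
  reversed {zero}  θ zero    = 1#
  reversed {zero}  θ (suc j) = 0#
  reversed {suc n} θ zero    = reversed (θ ∘ suc) 0
  reversed {suc n} θ (suc j) = reversed (θ ∘ suc) (suc j) + - θ zero * reversed (θ ∘ suc) j

  reversed-zero : ∀ {n} (θ : Fin n → Carrier) → reversed θ 0 ≈ 1#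
  reversed-zero {zero}  θ = refl
  reversed-zero {suc n} θ = reversed-zero (θ ∘ suc)

  reversed-above : ∀ {n} (θ : Fin n → Carrier) j → n ℕ.< j → reversed θ j ≈ 0#
  reversed-above {zero}  θ (suc j) _         = refl
  reversed-above {suc n} θ (suc j) (s≤s n<j) = trans
    (+-cong (reversed-above (θ ∘ suc) (suc j) (ℕ.m<n⇒m<1+n n<j)) (trans (*-congˡ (reversed-above (θ ∘ suc) j n<j)) (zeroʳ _))) (+-identityˡ 0#)

  coeff-∏X-above : ∀ {n} (θ : Fin n → Carrier) k → n ℕ.< k → coeff (∏X- θ) k ≈ 0#
  coeff-∏X-above {zero}  θ (suc k) _         = refl
  coeff-∏X-above {suc n} θ (suc k) (s≤s n<k) = trans (coeff-X-*ₚ-suc (θ zero) (∏X- (θ ∘ suc)) k) (trans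
    (+-cong (coeff-∏X-above (θ ∘ suc) k n<k) (trans (*-congˡ (coeff-∏X-above (θ ∘ suc) (suc k) (ℕ.m<n⇒m<1+n n<k))) (zeroʳ _))) (+-identityˡ 0#))

  coeff-∏X- : ∀ {n} (θ : Fin n → Carrier) k j → k ℕ.+ j ≡ n → coeff (∏X- θ) k ≈ reversed θ j
  coeff-∏X- {zero}  θ zero    zero    _  = refl
  coeff-∏X- {suc n} θ zero    (suc j) ≡.refl = begin
    coeff (∏X- θ) 0                                     ≈⟨ coeff-X-*ₚ-zero (θ zero) (∏X- (θ ∘ suc)) ⟩
    - θ zero * coeff (∏X- (θ ∘ suc)) 0                  ≈⟨ *-congˡ (coeff-∏X- (θ ∘ suc) 0 j ≡.refl) ⟩
    - θ zero * reversed (θ ∘ suc) j                     ≈⟨ +-identityˡ _ ⟨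
    0# + - θ zero * reversed (θ ∘ suc) j                ≈⟨ +-congʳ (reversed-above (θ ∘ suc) (suc j) ℕ.≤-refl) ⟨
    reversed θ (suc j)                                  ∎
  coeff-∏X- {suc n} θ (suc k) zero    eq = begin
    coeff (∏X- θ) (suc k)                                                        ≈⟨ coeff-X-*ₚ-suc (θ zero) (∏X- (θ ∘ suc)) k ⟩
    coeff (∏X- (θ ∘ suc)) k + - θ zero * coeff (∏X- (θ ∘ suc)) (suc k)
      ≈⟨ +-cong (coeff-∏X- (θ ∘ suc) k 0 (ℕ.suc-injective eq)) (trans (*-congˡ (coeff-∏X-above (θ ∘ suc) (suc k)
           (s≤s (ℕ.≤-reflexive (≡.trans (≡.sym (ℕ.suc-injective eq)) (ℕ.+-identityʳ k)))))) (zeroʳ _)) ⟩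
    reversed (θ ∘ suc) 0 + 0#                                                    ≈⟨ +-identityʳ _ ⟩
    reversed θ 0                                                                 ∎
  coeff-∏X- {suc n} θ (suc k) (suc j) eq = trans (coeff-X-*ₚ-suc (θ zero) (∏X- (θ ∘ suc)) k)
    (+-cong (coeff-∏X- (θ ∘ suc) k (suc j) (ℕ.suc-injective eq))
      (*-congˡ (coeff-∏X- (θ ∘ suc) (suc k) j (≡.trans (≡.sym (ℕ.+-suc k j)) (ℕ.suc-injective eq)))))

  -- Here g′ = (1 + a z) g; the product with f is compared one order at a time.
  ⊛-binomialʳ : ∀ f g g′ a → g′ 0 ≈ g 0 → (∀ j → g′ (suc j) ≈ g (suc j) + a * g j) →
    ∀ j → (f ⊛ g′) (suc j) ≈ (f ⊛ g) (suc j) + a * (f ⊛ g) j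
  ⊛-binomialʳ f g g′ a g′₀ g′ₛ zero = trans (+-cong (*-congˡ (g′ₛ 0)) (*-congˡ g′₀))
    (solve 5 (λ x y u v a → x :* (v :+ a :* u) :+ y :* u := (x :* v :+ y :* u) :+ a :* (x :* u)) refl (f 0) (f 1) (g 0) (g 1) a)
  ⊛-binomialʳ f g g′ a g′₀ g′ₛ (suc j) = trans (+-cong (*-congˡ (g′ₛ (suc j))) (⊛-binomialʳ (f ∘ suc) g g′ a g′₀ g′ₛ j))
    (solve 6 (λ x u v a p q → x :* (v :+ a :* u) :+ (p :+ a :* q) := (x :* v :+ p) :+ a :* (x :* u :+ q)) refl
      (f 0) (g (suc j)) (g (suc (suc j))) a (((f ∘ suc) ⊛ g) (suc j)) (((f ∘ suc) ⊛ g) j))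

  -- The geometric series of θ₀ is 1 / (1 - θ₀ z) and cancels the first factor of `reversed θ`.
  geometric-⊛ : ∀ {n} (θ : Fin (suc n) → Carrier) j → ((θ zero ^_) ⊛ reversed θ) j ≈ reversed (θ ∘ suc) j
  geometric-⊛ θ zero    = *-identityˡ _
  geometric-⊛ θ (suc j) = begin
    1# * (u + - x * v) + ((λ k → x * x ^ k) ⊛ reversed θ) j          ≈⟨ +-cong (*-identityˡ _) (⊛-cong (λ k → sym (+-identityʳ (x * x ^ k))) (λ _ → refl) j) ⟩
    (u + - x * v) + ((λ k → x * x ^ k + 0#) ⊛ reversed θ) j          ≈⟨ +-congˡ (⊛-linearˡ x (x ^_) (const 0#) (reversed θ) j) ⟩
    (u + - x * v) + (x * ((x ^_) ⊛ reversed θ) j + (const 0# ⊛ reversed θ) j) ≈⟨ +-congˡ (+-cong (*-congˡ (geometric-⊛ θ j)) (0-⊛ (reversed θ) j)) ⟩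
    (u + - x * v) + (x * v + 0#)                                     ≈⟨ solve 4 (λ u y x v → (u :+ y :* v) :+ (x :* v :+ con 0) := u :+ (y :+ x) :* v) refl u (- x) x v ⟩
    u + (- x + x) * v                                                ≈⟨ +-congˡ (trans (*-congʳ (-‿inverseˡ x)) (zeroˡ v)) ⟩
    u + 0#                                                           ≈⟨ +-identityʳ u ⟩
    u                                                                ∎
    where
    x = θ zero
    u = reversed (θ ∘ suc) (suc j)
    v = reversed (θ ∘ suc) j

  powerSums : ∀ {n} → (Fin n → Carrier) → ℕ → Carrier
  powerSums θ k = sum λ j → θ j ^ k

  powerSums-⊛ : ∀ {n} (θ : Fin (suc n) → Carrier) j →
    (powerSums θ ⊛ reversed θ) j ≈ reversed (θ ∘ suc) j + (powerSums (θ ∘ suc) ⊛ reversed θ) j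
  powerSums-⊛ θ j = begin
    (powerSums θ ⊛ reversed θ) j                                                       ≈⟨ ⊛-cong (λ k → +-congʳ (sym (*-identityˡ (θ zero ^ k)))) (λ _ → refl) j ⟩
    ((λ k → 1# * θ zero ^ k + powerSums (θ ∘ suc) k) ⊛ reversed θ) j                   ≈⟨ ⊛-linearˡ 1# (θ zero ^_) (powerSums (θ ∘ suc)) (reversed θ) j ⟩
    1# * ((θ zero ^_) ⊛ reversed θ) j + (powerSums (θ ∘ suc) ⊛ reversed θ) j           ≈⟨ +-congʳ (trans (*-identityˡ _) (geometric-⊛ θ j)) ⟩
    reversed (θ ∘ suc) j + (powerSums (θ ∘ suc) ⊛ reversed θ) j                        ∎

  -- In series form S F + z F′ = n F, the logarithmic derivative of F = ∏ (1 - θᵢ z). For a new root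
  -- put F = (1 + a z) G with a = -θ₀: the old identity times 1 + a z leaves over G from the new
  -- power sums and a z G from the product rule, which together are one more F.
  newton : ∀ {n} (θ : Fin n → Carrier) j →
    (powerSums θ ⊛ reversed θ) j + (j · 1#) * reversed θ j ≈ (n · 1#) * reversed θ j
  newton {zero}  θ zero    = trans (+-cong (zeroˡ _) (zeroˡ _)) (trans (+-identityˡ 0#) (sym (zeroˡ _)))
  newton {zero}  θ (suc j) = trans (+-cong (0-⊛ (reversed {zero} θ) (suc j)) (zeroʳ _)) (trans (+-identityˡ 0#) (sym (zeroˡ _)))
  newton {suc n} θ zero = begin
    (powerSums θ ⊛ reversed θ) 0 + 0# * w   ≈⟨ +-congʳ (powerSums-⊛ θ 0) ⟩
    (w + p) + 0# * w                        ≈⟨ +-assoc w p _ ⟩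
    w + (p + 0# * w)                        ≈⟨ +-congˡ (newton (θ ∘ suc) 0) ⟩
    w + (n · 1#) * w                       ≈⟨ solve 2 (λ w n → w :+ n :* w := (con 1 :+ n) :* w) refl w (n · 1#) ⟩
    (1# + n · 1#) * w                      ∎
    where
    w = reversed (θ ∘ suc) 0
    p = (powerSums (θ ∘ suc) ⊛ reversed θ) 0
  newton {suc n} θ (suc j) = begin
    (powerSums θ ⊛ reversed θ) (suc j) + (1# + j′) * (u + a * v)
      ≈⟨ +-congʳ (trans (powerSums-⊛ θ (suc j)) (+-congˡ (⊛-binomialʳ (powerSums (θ ∘ suc)) (reversed (θ ∘ suc)) (reversed θ) a refl (λ _ → refl) j))) ⟩
    (u + (x + a * y)) + (1# + j′) * (u + a * v)
      ≈⟨ solve 6 (λ u v a x y j → (u :+ (x :+ a :* y)) :+ (con 1 :+ j) :* (u :+ a :* v) := u :+ (x :+ (con 1 :+ j) :* u) :+ a :* (y :+ j :* v) :+ a :* v) refl u v a x y j′ ⟩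
    u + (x + (1# + j′) * u) + a * (y + j′ * v) + a * v
      ≈⟨ +-congʳ (+-cong (+-congˡ (newton (θ ∘ suc) (suc j))) (*-congˡ (newton (θ ∘ suc) j))) ⟩
    u + n′ * u + a * (n′ * v) + a * v
      ≈⟨ solve 4 (λ u v a n → u :+ n :* u :+ a :* (n :* v) :+ a :* v := (con 1 :+ n) :* (u :+ a :* v)) refl u v a n′ ⟩
    (1# + n′) * (u + a * v) ∎
    where
    a = - θ zero
    j′ = j · 1#
    n′ = n · 1#
    u = reversed (θ ∘ suc) (suc j)
    v = reversed (θ ∘ suc) j
    x = (powerSums (θ ∘ suc) ⊛ reversed (θ ∘ suc)) (suc j)
    y = (powerSums (θ ∘ suc) ⊛ reversed (θ ∘ suc)) j

-- Binomial coefficients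

module _ where
  open ≡-Reasoning
  open ℕ-Solver using (solve; _:=_; _:*_)

  binomial-factorial : ∀ k j → binomial (k ℕ.+ j) k ℕ.* (k ! ℕ.* j !) ≡ (k ℕ.+ j) !
  binomial-factorial k j = begin
    binomial n k ℕ.* (k ! ℕ.* j !)         ≡⟨ ≡.cong (λ i → binomial n k ℕ.* (k ! ℕ.* i !)) (≡.sym (ℕ.m+n∸m≡n k j)) ⟩
    binomial n k ℕ.* (k ! ℕ.* (n ∸ k) !)   ≡⟨ ≡.cong (ℕ._* (k ! ℕ.* (n ∸ k) !)) (nCk≡n!/k![n-k]! k≤n) ⟩
    (n ! ℕ./ (k ! ℕ.* (n ∸ k) !)) ℕ.* (k ! ℕ.* (n ∸ k) !) ≡⟨ m/n*n≡m (k![n∸k]!∣n! k≤n) ⟩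
    n !                                    ∎
    where
    n = k ℕ.+ j
    k≤n = ℕ.m≤m+n k j
    instance _ = k ℕ.!* (n ∸ k) !≢0

  -- Both sides become n! after multiplication by k! j!.
  binomial-absorb : ∀ {n} k j → k ℕ.+ suc j ≡ n → binomial n k ℕ.* suc j ≡ binomial n (suc k) ℕ.* suc k
  binomial-absorb k j ≡.refl = ℕ.*-cancelʳ-≡ _ _ (k ! ℕ.* j !) (begin
    b ℕ.* suc j ℕ.* (k ! ℕ.* j !)           ≡⟨ solve 4 (λ b j′ x y → b :* j′ :* (x :* y) := b :* (x :* (j′ :* y))) ≡.refl b (suc j) (k !) (j !) ⟩
    b ℕ.* (k ! ℕ.* suc j !)                 ≡⟨ binomial-factorial k (suc j) ⟩
    (k ℕ.+ suc j) !                         ≡⟨ ≡.cong _! (ℕ.+-suc k j) ⟩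
    (suc k ℕ.+ j) !                         ≡⟨ binomial-factorial (suc k) j ⟨
    binomial (suc k ℕ.+ j) (suc k) ℕ.* (suc k ! ℕ.* j !) ≡⟨ ≡.cong (λ m → binomial m (suc k) ℕ.* (suc k ! ℕ.* j !)) (≡.sym (ℕ.+-suc k j)) ⟩
    b′ ℕ.* (suc k ! ℕ.* j !)                ≡⟨ solve 4 (λ b k′ x y → b :* ((k′ :* x) :* y) := b :* k′ :* (x :* y)) ≡.refl b′ (suc k) (k !) (j !) ⟩
    b′ ℕ.* suc k ℕ.* (k ! ℕ.* j !)          ∎)
    where
    b = binomial (k ℕ.+ suc j) k
    b′ = binomial (k ℕ.+ suc j) (suc k)
    instance _ = k ℕ.!* j !≢0

-- Gauss's contiguous relations

open import Data.Rational.Base using (ℚ; 0ℚ; 1ℚ; _+_; _*_; _-_; -_; _÷_; 1/_; NonZero; ≢-nonZero; +-*-rawRing)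
import Data.Rational.Properties as ℚ
open import Data.Rational.Solver using (module +-*-Solver)
open RawSemiringDefs (RawRing.rawSemiring +-*-rawRing) using (_^_; product)
open Exp (CommutativeRing.commutativeSemiring ℚ.+-*-commutativeRing) using (^-distrib-*)
open SFraction ℚ.+-*-commutativeRing using (pivot)

module _ where
  open +-*-Solver using (solve; con; _:=_; _:+_; _:-_; _:*_; :-_)
  open ≡-Reasoning

  -- Total, with the default 0 at 0, so that the coefficients of a series can be written without
  -- proofs of nonvanishing; those are supplied where `*-inv` is used.
  inv : ℚ → ℚ
  inv p with p ℚ.≟ 0ℚ
  ... | yes _  = 0ℚ
  ... | no p≢0 = 1/_ p {{≢-nonZero p≢0}}

  *-inv : ∀ {p} → p ≢ 0ℚ → p * inv p ≡ 1ℚ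
  *-inv {p} p≢0 with p ℚ.≟ 0ℚ
  ... | yes p≡0 = contradiction p≡0 p≢0
  ... | no p≢0′ = ℚ.*-inverseʳ p {{≢-nonZero p≢0′}}

  *-cancelˡ : ∀ {p q r} → p ≢ 0ℚ → p * q ≡ p * r → q ≡ r
  *-cancelˡ {p} {q} {r} p≢0 pq≡pr = begin
    q              ≡⟨ ℚ.*-identityˡ q ⟨
    1ℚ * q         ≡⟨ ≡.cong (_* q) (*-inv p≢0) ⟨
    p * i * q      ≡⟨ solve 3 (λ p i q → p :* i :* q := i :* (p :* q)) ≡.refl p i q ⟩
    i * (p * q)    ≡⟨ ≡.cong (i *_) pq≡pr ⟩
    i * (p * r)    ≡⟨ solve 3 (λ p i q → p :* i :* q := i :* (p :* q)) ≡.refl p i r ⟨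
    p * i * r      ≡⟨ ≡.cong (_* r) (*-inv p≢0) ⟩
    1ℚ * r         ≡⟨ ℚ.*-identityˡ r ⟩
    r              ∎
    where i = inv p

  *-inv-unique : ∀ {p q} → p ≢ 0ℚ → p * q ≡ 1ℚ → q ≡ inv p
  *-inv-unique p≢0 pq≡1 = *-cancelˡ p≢0 (≡.trans pq≡1 (≡.sym (*-inv p≢0)))

  ÷≡*inv : ∀ p q .{{_ : NonZero q}} → p ÷ q ≡ p * inv q
  ÷≡*inv p q = ≡.cong (p *_) (*-inv-unique q≢0 (ℚ.*-inverseʳ q))
    where
    q≢0 : q ≢ 0ℚ
    q≢0 q≡0 = contradiction (≡.trans (≡.sym (≡.trans (≡.cong (_* 1/ q) q≡0) (ℚ.*-zeroˡ (1/ q)))) (ℚ.*-inverseʳ q)) λ ()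

  *-inv-cancel : ∀ {p} → p ≢ 0ℚ → ∀ q → p * (q * inv p) ≡ q
  *-inv-cancel {p} p≢0 q = begin
    p * (q * inv p)  ≡⟨ solve 3 (λ p i q → p :* (q :* i) := p :* i :* q) ≡.refl p (inv p) q ⟩
    p * inv p * q    ≡⟨ ≡.cong (_* q) (*-inv p≢0) ⟩
    1ℚ * q           ≡⟨ ℚ.*-identityˡ q ⟩
    q                ∎

  -- fromℕ as a sum of ones, so that the ring solver sees num (suc k) as 1ℚ + num k.
  num : ℕ → ℚ
  num zero    = 0ℚ
  num (suc k) = 1ℚ + num k

  num≡fromℕ : ∀ k → num k ≡ fromℕ k
  num≡fromℕ zero    = ≡.refl
  num≡fromℕ (suc k) = ≡.trans (≡.cong (1ℚ +_) (num≡fromℕ k)) (≡.sym (fromℕ-+ 1 k))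

  num-suc≢0 : ∀ k → num (suc k) ≢ 0ℚ
  num-suc≢0 k eq = contradiction (≡.trans (≡.sym (num≡fromℕ (suc k))) eq) λ ()

  +-num-suc : ∀ x k → x + 1ℚ + num k ≡ x + num (suc k)
  +-num-suc x k = ℚ.+-assoc x 1ℚ (num k)

  rising : ℚ → ℕ → ℚ
  rising x zero    = 1ℚ
  rising x (suc j) = rising x j * (x + num j)

  rising-head : ∀ x j → rising x (suc j) ≡ x * rising (x + 1ℚ) j
  rising-head x zero    = solve 1 (λ x → con 1ℚ :* (x :+ con 0ℚ) := x :* con 1ℚ) ≡.refl x
  rising-head x (suc j) = begin
    rising x (suc j) * (x + num (suc j))        ≡⟨ ≡.cong₂ _*_ (rising-head x j) (≡.sym (+-num-suc x j)) ⟩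
    x * rising (x + 1ℚ) j * (x + 1ℚ + num j)    ≡⟨ ℚ.*-assoc x _ _ ⟩
    x * rising (x + 1ℚ) (suc j)                 ∎

  rising-≢0 : ∀ x j → (∀ m → m ℕ.< j → x + num m ≢ 0ℚ) → rising x j ≢ 0ℚ
  rising-≢0 x zero    _   = λ ()
  rising-≢0 x (suc j) x≢0 = *-≢0 (rising-≢0 x j λ m m<j → x≢0 m (ℕ.m<n⇒m<1+n m<j)) (x≢0 j ℕ.≤-refl)

  rising-1≢0 : ∀ j → rising 1ℚ j ≢ 0ℚ
  rising-1≢0 j = rising-≢0 1ℚ j λ m _ → num-suc≢0 m

  +1-≢0 : ∀ Z {k} → (∀ m → m ℕ.< suc k → Z + num m ≢ 0ℚ) → ∀ m → m ℕ.< k → Z + 1ℚ + num m ≢ 0ℚ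
  +1-≢0 Z Z≢0 m m<k = Z≢0 (suc m) (s≤s m<k) ∘ ≡.trans (≡.sym (+-num-suc Z m))

  -- The coefficient of zʲ, with the junk value 0ℚ when Z + m = 0 for some m < j.
  ₂F₁ : ℚ → ℚ → ℚ → ℕ → ℚ
  ₂F₁ X Y Z j = rising X j * rising Y j * inv (rising Z j * rising 1ℚ j)

  ₂F₁-sym : ∀ X Y Z j → ₂F₁ X Y Z j ≡ ₂F₁ Y X Z j
  ₂F₁-sym X Y Z j = ≡.cong (_* inv (rising Z j * rising 1ℚ j)) (ℚ.*-comm (rising X j) (rising Y j))

  ₂F₁-clear : ∀ X Y Z j → (∀ m → m ℕ.< j → Z + num m ≢ 0ℚ) →
    rising Z j * rising 1ℚ j * ₂F₁ X Y Z j ≡ rising X j * rising Y j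
  ₂F₁-clear X Y Z j Z≢0 = *-inv-cancel (*-≢0 (rising-≢0 Z j Z≢0) (rising-1≢0 j)) _

  -- From X (X + 1)ⱼ = (X)ⱼ (X + j). Both sides carry the same `inv` factor, so the identity holds
  -- for the default values too.
  ₂F₁-raiseˡ : ∀ X Y Z j → X * ₂F₁ (X + 1ℚ) Y Z j ≡ (X + num j) * ₂F₁ X Y Z j
  ₂F₁-raiseˡ X Y Z j = begin
    X * (rising (X + 1ℚ) j * rising Y j * i)       ≡⟨ solve 4 (λ x a b i → x :* (a :* b :* i) := x :* a :* b :* i) ≡.refl X (rising (X + 1ℚ) j) (rising Y j) i ⟩
    X * rising (X + 1ℚ) j * rising Y j * i         ≡⟨ ≡.cong (λ r → r * rising Y j * i) (rising-head X j) ⟨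
    rising X j * (X + num j) * rising Y j * i      ≡⟨ solve 4 (λ x a b i → a :* x :* b :* i := x :* (a :* b :* i)) ≡.refl (X + num j) (rising X j) (rising Y j) i ⟩
    (X + num j) * (rising X j * rising Y j * i)    ∎
    where i = inv (rising Z j * rising 1ℚ j)

  -- With denominators cleared and the common Pochhammer symbols removed, this is X Y = (X + 1 + j)
  -- Y - Y (1 + j).
  contiguous-raiseˡ : ∀ X Y Z c j → (∀ m → m ℕ.< suc j → Z + num m ≢ 0ℚ) → c * Z ≡ - Y →
    ₂F₁ X Y Z (suc j) ≡ ₂F₁ (X + 1ℚ) Y Z (suc j) + c * ₂F₁ (X + 1ℚ) (Y + 1ℚ) (Z + 1ℚ) j
  contiguous-raiseˡ X Y Z c j Z≢0 cZ≡-Y = *-cancelˡ (*-≢0 (rising-≢0 Z (suc j) Z≢0) (rising-1≢0 (suc j))) (begin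
    rising Z (suc j) * f * ₂F₁ X Y Z (suc j)                ≡⟨ ₂F₁-clear X Y Z (suc j) Z≢0 ⟩
    rising X (suc j) * rising Y (suc j)                     ≡⟨ ≡.cong₂ _*_ (rising-head X j) (rising-head Y j) ⟩
    X * a * (Y * b)                                         ≡⟨ solve 5 (λ x y a b n → x :* a :* (y :* b) := a :* (x :+ con 1ℚ :+ n) :* (y :* b) :+ :- y :* (a :* b) :* (con 1ℚ :+ n)) ≡.refl X Y a b n ⟩
    a * (X + 1ℚ + n) * (Y * b) + - Y * (a * b) * (1ℚ + n)   ≡⟨ ≡.cong₂ (λ u v → a * (X + 1ℚ + n) * u + v * (1ℚ + n)) (rising-head Y j) (≡.cong₂ _*_ cZ≡-Y (₂F₁-clear (X + 1ℚ) (Y + 1ℚ) (Z + 1ℚ) j (+1-≢0 Z Z≢0))) ⟨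
    rising (X + 1ℚ) (suc j) * rising Y (suc j) + c * Z * (w * f₀ * g) * (1ℚ + n)
      ≡⟨ ≡.cong₂ _+_ (≡.sym (₂F₁-clear (X + 1ℚ) Y Z (suc j) Z≢0)) (solve 6 (λ c z w f g n → c :* z :* (w :* f :* g) :* (con 1ℚ :+ n) := z :* w :* (f :* (con 1ℚ :+ n)) :* (c :* g)) ≡.refl c Z w f₀ g n) ⟩
    rising Z (suc j) * f * g₁ + Z * w * f * (c * g)         ≡⟨ ≡.cong (λ r → rising Z (suc j) * f * g₁ + r * f * (c * g)) (rising-head Z j) ⟨
    rising Z (suc j) * f * g₁ + rising Z (suc j) * f * (c * g) ≡⟨ ℚ.*-distribˡ-+ (rising Z (suc j) * f) g₁ (c * g) ⟨
    rising Z (suc j) * f * (g₁ + c * g)                     ∎)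
    where
    n = num j
    f₀ = rising 1ℚ j
    f = rising 1ℚ (suc j)
    a = rising (X + 1ℚ) j
    b = rising (Y + 1ℚ) j
    w = rising (Z + 1ℚ) j
    g₁ = ₂F₁ (X + 1ℚ) Y Z (suc j)
    g = ₂F₁ (X + 1ℚ) (Y + 1ℚ) (Z + 1ℚ) j

  -- With denominators cleared and common factors removed, this is (Z + 1 + j) Y = Z (Y + 1 + j) +
  -- (Y - Z) (1 + j). The denominators on the right reach Z + 1 + j, so the clearing factor is
  -- (Z)ⱼ₊₂ and not the (Z)ⱼ₊₁ of the left side.
  contiguous-gauss : ∀ X Y Z c j → (∀ m → m ℕ.< suc (suc j) → Z + num m ≢ 0ℚ) → c * (Z * (Z + 1ℚ)) ≡ X * (Y - Z) →
    ₂F₁ X Y Z (suc j) ≡ ₂F₁ X (Y + 1ℚ) (Z + 1ℚ) (suc j) + c * ₂F₁ (X + 1ℚ) (Y + 1ℚ) (Z + 1ℚ + 1ℚ) j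
  contiguous-gauss X Y Z c j Z≢0 hc = *-cancelˡ (*-≢0 (rising-≢0 Z (suc (suc j)) Z≢0) (rising-1≢0 (suc j))) (begin
    rising Z (suc (suc j)) * f * g₀
      ≡⟨ solve 4 (λ p q f g → p :* q :* f :* g := q :* (p :* f :* g)) ≡.refl (rising Z (suc j)) (Z + num (suc j)) f g₀ ⟩
    (Z + num (suc j)) * (rising Z (suc j) * f * g₀)
      ≡⟨ ≡.cong₂ _*_ (≡.sym (+-num-suc Z j)) (₂F₁-clear X Y Z (suc j) λ m m≤j → Z≢0 m (ℕ.m<n⇒m<1+n m≤j)) ⟩
    (Z + 1ℚ + n) * (rising X (suc j) * rising Y (suc j))
      ≡⟨ ≡.cong ((Z + 1ℚ + n) *_) (≡.cong₂ _*_ (rising-head X j) (rising-head Y j)) ⟩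
    (Z + 1ℚ + n) * (X * a * (Y * b))
      ≡⟨ solve 6 (λ x y z a b n → (z :+ con 1ℚ :+ n) :* (x :* a :* (y :* b)) := z :* (x :* a :* (b :* (y :+ con 1ℚ :+ n))) :+ x :* (y :- z) :* (a :* b) :* (con 1ℚ :+ n)) ≡.refl X Y Z a b n ⟩
    Z * (X * a * rising (Y + 1ℚ) (suc j)) + X * (Y - Z) * (a * b) * (1ℚ + n)
      ≡⟨ ≡.cong₂ (λ u v → Z * (u * rising (Y + 1ℚ) (suc j)) + v * (1ℚ + n)) (rising-head X j) (≡.cong₂ _*_ hc (₂F₁-clear (X + 1ℚ) (Y + 1ℚ) (Z + 1ℚ + 1ℚ) j (+1-≢0 (Z + 1ℚ) (+1-≢0 Z Z≢0)))) ⟨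
    Z * (rising X (suc j) * rising (Y + 1ℚ) (suc j)) + c * (Z * (Z + 1ℚ)) * (v * f₀ * g) * (1ℚ + n)
      ≡⟨ ≡.cong₂ _+_ (≡.cong (Z *_) (≡.sym (₂F₁-clear X (Y + 1ℚ) (Z + 1ℚ) (suc j) (+1-≢0 Z Z≢0)))) (solve 6 (λ c z v f g n → c :* (z :* (z :+ con 1ℚ)) :* (v :* f :* g) :* (con 1ℚ :+ n) := z :* ((z :+ con 1ℚ) :* v) :* (f :* (con 1ℚ :+ n)) :* (c :* g)) ≡.refl c Z v f₀ g n) ⟩
    Z * (r * f * g₁) + Z * ((Z + 1ℚ) * v) * f * (c * g)
      ≡⟨ ≡.cong (λ u → Z * (r * f * g₁) + Z * u * f * (c * g)) (rising-head (Z + 1ℚ) j) ⟨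
    Z * (r * f * g₁) + Z * r * f * (c * g)
      ≡⟨ solve 5 (λ z r f x y → z :* (r :* f :* x) :+ z :* r :* f :* y := z :* r :* f :* (x :+ y)) ≡.refl Z r f g₁ (c * g) ⟩
    Z * r * f * (g₁ + c * g)
      ≡⟨ ≡.cong (λ u → u * f * (g₁ + c * g)) (rising-head Z (suc j)) ⟨
    rising Z (suc (suc j)) * f * (g₁ + c * g) ∎)
    where
    n = num j
    f₀ = rising 1ℚ j
    f = rising 1ℚ (suc j)
    a = rising (X + 1ℚ) j
    b = rising (Y + 1ℚ) j
    r = rising (Z + 1ℚ) (suc j)
    v = rising (Z + 1ℚ + 1ℚ) j
    g₀ = ₂F₁ X Y Z (suc j)
    g₁ = ₂F₁ X (Y + 1ℚ) (Z + 1ℚ) (suc j)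
    g = ₂F₁ (X + 1ℚ) (Y + 1ℚ) (Z + 1ℚ + 1ℚ) j

  -- Exchanging the numerator parameters at every step makes contiguous-gauss serve
  -- the steps of both parities.
  gaussSeries : ℚ → ℚ → ℚ → ℕ → ℕ → ℚ
  gaussSeries X Y Z zero    = ₂F₁ X Y Z
  gaussSeries X Y Z (suc k) = gaussSeries (Y + 1ℚ) X (Z + 1ℚ) k

  gaussCoeff : ℚ → ℚ → ℚ → ℕ → ℚ
  gaussCoeff X Y Z zero    = X * (Y - Z) * inv (Z * (Z + 1ℚ))
  gaussCoeff X Y Z (suc k) = gaussCoeff (Y + 1ℚ) X (Z + 1ℚ) k

  gaussSeries-zero : ∀ k X Y Z → gaussSeries X Y Z k 0 ≡ 1ℚ
  gaussSeries-zero zero    X Y Z = ≡.refl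
  gaussSeries-zero (suc k) X Y Z = gaussSeries-zero k (Y + 1ℚ) X (Z + 1ℚ)

  gaussCoeff-clear : ∀ X Y Z → (∀ m → m ℕ.< 2 → Z + num m ≢ 0ℚ) →
    X * (Y - Z) * inv (Z * (Z + 1ℚ)) * (Z * (Z + 1ℚ)) ≡ X * (Y - Z)
  gaussCoeff-clear X Y Z Z≢0 = ≡.trans (ℚ.*-comm _ (Z * (Z + 1ℚ))) (*-inv-cancel
    (*-≢0 (Z≢0 0 (s≤s z≤n) ∘ ≡.trans (ℚ.+-identityʳ Z)) (Z≢0 1 ℕ.≤-refl)) _)

  gaussSeries-step : ∀ k X Y Z j → (∀ m → m ℕ.< suc (suc (k ℕ.+ j)) → Z + num m ≢ 0ℚ) →
    gaussSeries X Y Z k (suc j) ≡ gaussSeries X Y Z (suc k) (suc j) + gaussCoeff X Y Z k * gaussSeries X Y Z (suc (suc k)) j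
  gaussSeries-step zero X Y Z j Z≢0 = ≡.trans
    (contiguous-gauss X Y Z (gaussCoeff X Y Z 0) j Z≢0 (gaussCoeff-clear X Y Z λ m m<2 → Z≢0 m (ℕ.≤-trans m<2 (s≤s (s≤s z≤n)))))
    (≡.cong (_+ gaussCoeff X Y Z 0 * ₂F₁ (X + 1ℚ) (Y + 1ℚ) (Z + 1ℚ + 1ℚ) j) (₂F₁-sym X (Y + 1ℚ) (Z + 1ℚ) (suc j)))
  gaussSeries-step (suc k) X Y Z j Z≢0 = gaussSeries-step k (Y + 1ℚ) X (Z + 1ℚ) j (+1-≢0 Z Z≢0)

  -- The Hₖ of the S-fraction. From H₀ to H₁ only the first parameter is raised, which is a step of
  -- `contiguous-raiseˡ`; Gauss's chain begins at H₁.
  remainder : ℚ → ℚ → ℚ → ℕ → ℕ → ℚ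
  remainder A B C zero    = ₂F₁ A B C
  remainder A B C (suc k) = gaussSeries (A + 1ℚ) B C k

  quotient : ℚ → ℚ → ℚ → ℕ → ℚ
  quotient A B C zero    = - B * inv C
  quotient A B C (suc k) = gaussCoeff (A + 1ℚ) B C k

  remainder-zero : ∀ A B C k → remainder A B C k 0 ≡ 1ℚ
  remainder-zero A B C zero    = ≡.refl
  remainder-zero A B C (suc k) = gaussSeries-zero k (A + 1ℚ) B C

  remainder-step : ∀ A B C T → (∀ m → m ℕ.< T → C + num m ≢ 0ℚ) → ∀ k j → k ℕ.+ j ℕ.< T →
    remainder A B C k (suc j) ≡ remainder A B C (suc k) (suc j) + quotient A B C k * remainder A B C (suc (suc k)) j
  remainder-step A B C T C≢0 zero j j<T = ≡.trans
    (contiguous-raiseˡ A B C (- B * inv C) j (λ m m≤j → C≢0 m (ℕ.≤-trans m≤j j<T))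
      (≡.trans (ℚ.*-comm (- B * inv C) C) (*-inv-cancel (C≢0 0 (ℕ.≤-trans (s≤s z≤n) j<T) ∘ ≡.trans (ℚ.+-identityʳ C)) (- B))))
    (≡.cong (λ u → ₂F₁ (A + 1ℚ) B C (suc j) + - B * inv C * u) (₂F₁-sym (A + 1ℚ) (B + 1ℚ) (C + 1ℚ) j))
  remainder-step A B C T C≢0 (suc k) j k+j<T = gaussSeries-step k (A + 1ℚ) B C j λ m m<2+k+j → C≢0 m (ℕ.≤-trans m<2+k+j k+j<T)

  -- Jacobi polynomials

  num-+ : ∀ m n → num (m ℕ.+ n) ≡ num m + num n
  num-+ m n = ≡.trans (num≡fromℕ (m ℕ.+ n)) (≡.trans (fromℕ-+ m n) (≡.cong₂ _+_ (≡.sym (num≡fromℕ m)) (≡.sym (num≡fromℕ n))))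

  num-* : ∀ m n → num (m ℕ.* n) ≡ num m * num n
  num-* zero    n = ≡.sym (ℚ.*-zeroˡ (num n))
  num-* (suc m) n = begin
    num (n ℕ.+ m ℕ.* n)     ≡⟨ num-+ n (m ℕ.* n) ⟩
    num n + num (m ℕ.* n)   ≡⟨ ≡.cong (num n +_) (num-* m n) ⟩
    num n + num m * num n   ≡⟨ solve 2 (λ m n → n :+ m :* n := (con 1ℚ :+ m) :* n) ≡.refl (num m) (num n) ⟩
    (1ℚ + num m) * num n    ∎

  -- The products `∏ᵇ` by start and length instead of `Fin`, convenient for splitting off factors at
  -- either end.
  segment : (ℕ → ℚ) → ℕ → ℕ → ℚ
  segment g lo zero      = 1ℚ
  segment g lo (suc len) = g lo * segment g (suc lo) len

  product-segment : ∀ len lo (f : Fin len → ℚ) g → (∀ i → f i ≡ g (lo ℕ.+ toℕ i)) → product f ≡ segment g lo len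
  product-segment zero      lo f g f≡g = ≡.refl
  product-segment (suc len) lo f g f≡g = ≡.cong₂ _*_
    (≡.trans (f≡g zero) (≡.cong g (ℕ.+-identityʳ lo)))
    (product-segment len (suc lo) (f ∘ suc) g λ i → ≡.trans (f≡g (suc i)) (≡.cong g (ℕ.+-suc lo (toℕ i))))

  ∏ᵇ-segment : ∀ lo hi len f g → (∀ k p q → f k p q ≡ g k) → lo ℕ.+ len ≡ suc hi → ∏ᵇ lo hi f ≡ segment g lo len
  ∏ᵇ-segment lo hi len f g f≡g eq = ≡.trans
    (product-segment (suc hi ∸ lo) lo _ g λ i → f≡g _ _ _)
    (≡.cong (segment g lo) (≡.trans (≡.cong (_∸ lo) (≡.sym eq)) (ℕ.m+n∸m≡n lo len)))

  ₂F₁-suc : ∀ X Y Z j → (∀ m → m ℕ.< suc j → Z + num m ≢ 0ℚ) →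
    (Z + num j) * num (suc j) * ₂F₁ X Y Z (suc j) ≡ (X + num j) * (Y + num j) * ₂F₁ X Y Z j
  ₂F₁-suc X Y Z j Z≢0 = *-cancelˡ (*-≢0 (rising-≢0 Z j Z≢0′) (rising-1≢0 j)) (begin
    z * f * ((Z + n) * (1ℚ + n) * g′)       ≡⟨ solve 5 (λ z f u n g → z :* f :* (u :* (con 1ℚ :+ n) :* g) := z :* u :* (f :* (con 1ℚ :+ n)) :* g) ≡.refl z f (Z + n) n g′ ⟩
    rising Z (suc j) * rising 1ℚ (suc j) * g′ ≡⟨ ₂F₁-clear X Y Z (suc j) Z≢0 ⟩
    x * (X + n) * (y * (Y + n))             ≡⟨ solve 4 (λ x u y v → x :* u :* (y :* v) := u :* v :* (x :* y)) ≡.refl x (X + n) y (Y + n) ⟩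
    (X + n) * (Y + n) * (x * y)             ≡⟨ ≡.cong ((X + n) * (Y + n) *_) (₂F₁-clear X Y Z j Z≢0′) ⟨
    (X + n) * (Y + n) * (z * f * g)         ≡⟨ solve 3 (λ u w g → u :* (w :* g) := w :* (u :* g)) ≡.refl ((X + n) * (Y + n)) (z * f) g ⟩
    z * f * ((X + n) * (Y + n) * g)         ∎)
    where
    Z≢0′ : ∀ m → m ℕ.< j → Z + num m ≢ 0ℚ
    Z≢0′ m m<j = Z≢0 m (ℕ.m<n⇒m<1+n m<j)
    n = num j
    x = rising X j
    y = rising Y j
    z = rising Z j
    f = rising 1ℚ j
    g = ₂F₁ X Y Z j
    g′ = ₂F₁ X Y Z (suc j)

  rising-negative : ∀ n j → n ℕ.< j → rising (- num n) j ≡ 0ℚ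
  rising-negative n (suc j) n≤j with ℕ.m≤n⇒m<n∨m≡n (ℕ.s≤s⁻¹ n≤j)
  ... | inj₁ n<j    = ≡.trans (≡.cong (_* (- num n + num j)) (rising-negative n j n<j)) (ℚ.*-zeroˡ (- num n + num j))
  ... | inj₂ ≡.refl = ≡.trans (≡.cong (rising (- num n) n *_) (ℚ.+-inverseˡ (num n))) (ℚ.*-zeroʳ (rising (- num n) n))

  module Parameters (n : ℕ) (α β : ℚ) where
    a b c : ℚ
    a = - num n
    b = - (num n + α)
    c = - (num n + num n + (α + β))

    -- c + m = -(α + β + j) with j = 2n - m. Thus m < n corresponds to j ≥ n + 1, and m < 2t - 2 to
    -- j ≥ 2n - 2t + 3, the two hypotheses of the theorem.
    c+num≢0 : ∀ m → m ≤ 2 ℕ.* n → α + β + fromℕ (2 ℕ.* n ∸ m) ≢ 0ℚ → c + num m ≢ 0ℚ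
    c+num≢0 m m≤2n ≢0 eq = ≢0 (begin
      α + β + fromℕ (2 ℕ.* n ∸ m)    ≡⟨ ≡.cong (α + β +_) (num≡fromℕ (2 ℕ.* n ∸ m)) ⟨
      α + β + x                      ≡⟨ solve 3 (λ s x m → s :+ x := :- (:- (x :+ m :+ s) :+ m)) ≡.refl (α + β) x (num m) ⟩
      - (- (x + num m + (α + β)) + num m) ≡⟨ ≡.cong (λ u → - (- (u + (α + β)) + num m)) (≡.trans (≡.sym (num-+ (2 ℕ.* n ∸ m) m)) (≡.trans (≡.cong num (≡.trans (ℕ.m∸n+n≡m m≤2n) (≡.cong (n ℕ.+_) (ℕ.+-identityʳ n)))) (num-+ n n))) ⟩
      - (c + num m)                  ≡⟨ ≡.cong -_ eq ⟩
      0ℚ                             ∎)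
      where x = num (2 ℕ.* n ∸ m)

    module _ (h : ∀ j → n ℕ.+ 1 ≤ j → j ≤ 2 ℕ.* n → α + β + fromℕ j ≢ 0ℚ) where

      c≢0 : ∀ m → m ℕ.< n → c + num m ≢ 0ℚ
      c≢0 m m<n = c+num≢0 m m≤2n (h (2 ℕ.* n ∸ m) lower (ℕ.m∸n≤m (2 ℕ.* n) m))
        where
        m≤2n : m ≤ 2 ℕ.* n
        m≤2n = ℕ.≤-trans (ℕ.<⇒≤ m<n) (ℕ.m≤m+n n _)
        lower : n ℕ.+ 1 ≤ 2 ℕ.* n ∸ m
        lower = ℕ.m+n≤o⇒m≤o∸n (n ℕ.+ 1) (≡.subst (_≤ 2 ℕ.* n) (≡.sym (ℕ.+-assoc n 1 m)) (ℕ.+-monoʳ-≤ n (ℕ.≤-trans m<n (ℕ.m≤m+n n 0))))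

      ratio : ℕ → ℚ
      ratio k = (α + num k) * inv (num n + α + β + num k)

      -- Both sides are 1 at j = 0 and have the same ratio of consecutive terms. With q = k + 1 and
      -- n = q + j, the factors in `₂F₁-suc` are a + j = -q, b + j = -(α + q) and c + j = -(n + α +
      -- β + q). Two of the signs cancel and the third is the alternating sign of the Jacobi
      -- coefficients.
      coefficient : ∀ k j → k ℕ.+ j ≡ n → num (binomial n k) * segment ratio (suc k) j * (- 1ℚ) ^ j ≡ ₂F₁ a b c j
      coefficient k zero    eq = begin
        num (binomial n k) * 1ℚ * 1ℚ   ≡⟨ ≡.cong (λ m → num m * 1ℚ * 1ℚ) (≡.trans (≡.cong (binomial n) (≡.trans (≡.sym (ℕ.+-identityʳ k)) eq)) (nCn≡1 n)) ⟩
        1ℚ                             ∎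
      coefficient k (suc j) eq = *-cancelˡ (*-≢0 (c≢0 j j<n) (num-suc≢0 j)) (begin
        (c + num j) * num (suc j) * (num (binomial n k) * ((α + q) * inv d * s) * (- 1ℚ * e))
          ≡⟨ solve 8 (λ c J N A i s e m → c :* J :* (N :* (A :* i :* s) :* (m :* e)) := N :* J :* (m :* c :* i) :* (A :* s :* e)) ≡.refl (c + num j) (num (suc j)) (num (binomial n k)) (α + q) (inv d) s e (- 1ℚ) ⟩
        num (binomial n k) * num (suc j) * (- 1ℚ * (c + num j) * inv d) * ((α + q) * s * e)
          ≡⟨ ≡.cong₂ (λ u v → u * v * ((α + q) * s * e)) absorb (≡.trans (≡.cong (_* inv d) -c≡d) (*-inv d≢0)) ⟩
        N * q * 1ℚ * ((α + q) * s * e)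
          ≡⟨ solve 5 (λ N q A s e → N :* q :* con 1ℚ :* (A :* s :* e) := :- q :* :- A :* (N :* s :* e)) ≡.refl N q (α + q) s e ⟩
        - q * - (α + q) * (N * s * e)
          ≡⟨ ≡.cong₂ (λ u v → u * v * (N * s * e)) a+j b+j ⟨
        (a + num j) * (b + num j) * (N * s * e)
          ≡⟨ ≡.cong ((a + num j) * (b + num j) *_) (coefficient (suc k) j eq′) ⟩
        (a + num j) * (b + num j) * ₂F₁ a b c j
          ≡⟨ ₂F₁-suc a b c j (λ m m≤j → c≢0 m (ℕ.<-≤-trans m≤j j<n)) ⟨
        (c + num j) * num (suc j) * ₂F₁ a b c (suc j) ∎)
        where
        q = num (suc k)
        s = segment ratio (suc (suc k)) j
        e = (- 1ℚ) ^ j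
        d = num n + α + β + q
        N = num (binomial n (suc k))
        eq′ : suc k ℕ.+ j ≡ n
        eq′ = ≡.trans (≡.sym (ℕ.+-suc k j)) eq
        j<n : j ℕ.< n
        j<n = ≡.subst (j ℕ.<_) eq′ (s≤s (ℕ.m≤n+m j k))
        n≡q+j : num n ≡ q + num j
        n≡q+j = ≡.trans (≡.cong num (≡.sym eq′)) (num-+ (suc k) j)
        a+j : a + num j ≡ - q
        a+j = ≡.trans (≡.cong (λ u → - u + num j) n≡q+j) (solve 2 (λ q j → :- (q :+ j) :+ j := :- q) ≡.refl q (num j))
        b+j : b + num j ≡ - (α + q)
        b+j = ≡.trans (≡.cong (λ u → - (u + α) + num j) n≡q+j) (solve 3 (λ q j A → :- (q :+ j :+ A) :+ j := :- (A :+ q)) ≡.refl q (num j) α)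
        -c≡d : - 1ℚ * (c + num j) ≡ d
        -c≡d = ≡.trans (≡.cong (λ u → - 1ℚ * (- (num n + u + (α + β)) + num j)) n≡q+j)
          (solve 5 (λ n q j A B → :- con 1ℚ :* (:- (n :+ (q :+ j) :+ (A :+ B)) :+ j) := n :+ A :+ B :+ q) ≡.refl (num n) q (num j) α β)
        d≢0 : d ≢ 0ℚ
        d≢0 d≡0 = *-≢0 { - 1ℚ} {c + num j} (λ ()) (c≢0 j j<n) (≡.trans -c≡d d≡0)
        absorb : num (binomial n k) * num (suc j) ≡ N * q
        absorb = ≡.trans (≡.sym (num-* (binomial n k) (suc j))) (≡.trans (≡.cong num (binomial-absorb k j eq)) (num-* (binomial n (suc k)) (suc k)))

      jacobiCoeff≡₂F₁ : ∀ k j → k ℕ.+ j ≡ n → jacobiCoeff n α β h k ≡ ₂F₁ a b c j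
      jacobiCoeff≡₂F₁ k j eq = ≡.trans (≡.cong₂ _*_ (≡.cong₂ _*_ (≡.sym (num≡fromℕ (binomial n k)))
        (∏ᵇ-segment (suc k) n j _ ratio (λ m p q → ≡.trans (÷≡*inv (α + fromℕ m) (fromℕ n + α + β + fromℕ m) {{jacobiDenominator-nonZero n α β h m (ℕ.≤-trans (s≤s z≤n) p) q}})
          (≡.cong₂ (λ u v → (α + v) * inv (u + α + β + v)) (≡.sym (num≡fromℕ n)) (≡.sym (num≡fromℕ m)))) (≡.cong suc eq)))
        (≡.cong ((- 1ℚ) ^_) (≡.trans (≡.cong (_∸ k) (≡.sym eq)) (ℕ.m+n∸m≡n k j))))
        (coefficient k j eq)

  -- The product of the pivots

  segment-cong : ∀ {f g : ℕ → ℚ} lo len → (∀ k → lo ≤ k → f k ≡ g k) → segment f lo len ≡ segment g lo len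
  segment-cong lo zero      f≡g = ≡.refl
  segment-cong lo (suc len) f≡g = ≡.cong₂ _*_ (f≡g lo ℕ.≤-refl) (segment-cong (suc lo) len λ k lo<k → f≡g k (ℕ.<⇒≤ lo<k))

  segment-* : ∀ (f g : ℕ → ℚ) lo len → segment (λ k → f k * g k) lo len ≡ segment f lo len * segment g lo len
  segment-* f g lo zero      = ≡.refl
  segment-* f g lo (suc len) = ≡.trans (≡.cong (f lo * g lo *_) (segment-* f g (suc lo) len))
    (solve 4 (λ a b x y → a :* b :* (x :* y) := a :* x :* (b :* y)) ≡.refl (f lo) (g lo) (segment f (suc lo) len) (segment g (suc lo) len))

  segment-last : ∀ (f : ℕ → ℚ) lo len → segment f lo (suc len) ≡ segment f lo len * f (lo ℕ.+ len)
  segment-last f lo zero      = ≡.trans (ℚ.*-comm (f lo) 1ℚ) (≡.cong (λ k → 1ℚ * f k) (≡.sym (ℕ.+-identityʳ lo)))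
  segment-last f lo (suc len) = begin
    f lo * segment f (suc lo) (suc len)                       ≡⟨ ≡.cong (f lo *_) (segment-last f (suc lo) len) ⟩
    f lo * (segment f (suc lo) len * f (suc lo ℕ.+ len))      ≡⟨ ℚ.*-assoc (f lo) _ _ ⟨
    segment f lo (suc len) * f (suc lo ℕ.+ len)               ≡⟨ ≡.cong (λ k → segment f lo (suc len) * f k) (≡.sym (ℕ.+-suc lo len)) ⟩
    segment f lo (suc len) * f (lo ℕ.+ suc len)               ∎

  falling : ℚ → ℕ → ℚ
  falling x zero    = 1ℚ
  falling x (suc k) = falling x k * (x - num k)

  falling-head : ∀ x k → falling (1ℚ + x) (suc k) ≡ (1ℚ + x) * falling x k
  falling-head x zero    = solve 1 (λ x → con 1ℚ :* (con 1ℚ :+ x :- con 0ℚ) := (con 1ℚ :+ x) :* con 1ℚ) ≡.refl x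
  falling-head x (suc k) = ≡.trans (≡.cong (_* (1ℚ + x - num (suc k))) (falling-head x k))
    (solve 3 (λ x f n → (con 1ℚ :+ x) :* f :* (con 1ℚ :+ x :- (con 1ℚ :+ n)) := (con 1ℚ :+ x) :* (f :* (x :- n))) ≡.refl x (falling x k) (num k))

  -- Equal to the product of (x - i)^(k - 1 - i) over i < k. The products in A, B and C take this
  -- form when read from their largest index downwards.
  superfalling : ℚ → ℕ → ℚ
  superfalling x zero    = 1ℚ
  superfalling x (suc k) = superfalling x k * falling x k

  segment-falling : ∀ x lo l → segment (λ k → x + num k) lo (suc l) ≡ falling (x + num (lo ℕ.+ l)) (suc l)
  segment-falling x lo zero    = ≡.trans (≡.cong (λ k → (x + num k) * 1ℚ) (≡.sym (ℕ.+-identityʳ lo)))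
    (solve 1 (λ y → y :* con 1ℚ := con 1ℚ :* (y :- con 0ℚ)) ≡.refl (x + num (lo ℕ.+ 0)))
  segment-falling x lo (suc l) = begin
    segment (λ k → x + num k) lo (suc (suc l))                              ≡⟨ segment-last (λ k → x + num k) lo (suc l) ⟩
    segment (λ k → x + num k) lo (suc l) * (x + num (lo ℕ.+ suc l))         ≡⟨ ≡.cong₂ _*_ (segment-falling x lo l) top ⟩
    falling y (suc l) * (1ℚ + y)                                            ≡⟨ ℚ.*-comm (falling y (suc l)) (1ℚ + y) ⟩
    (1ℚ + y) * falling y (suc l)                                            ≡⟨ falling-head y (suc l) ⟨
    falling (1ℚ + y) (suc (suc l))                                          ≡⟨ ≡.cong (λ u → falling u (suc (suc l))) top ⟨
    falling (x + num (lo ℕ.+ suc l)) (suc (suc l))                          ∎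
    where
    y = x + num (lo ℕ.+ l)
    top : x + num (lo ℕ.+ suc l) ≡ 1ℚ + y
    top = ≡.trans (≡.cong (λ k → x + num k) (ℕ.+-suc lo l)) (solve 2 (λ x m → x :+ (con 1ℚ :+ m) := con 1ℚ :+ (x :+ m)) ≡.refl x (num (lo ℕ.+ l)))

  powers : ℚ → ℕ → ℕ → ℚ
  powers x lo k = (x + num k) ^ (k ∸ lo)

  -- The factor at `lo` has exponent 0. Taking one power out of each remaining factor leaves a
  -- falling factorial times the same product started at `suc lo`. The tail version serves the
  -- products whose first exponent is 1, as in A and in the α and β factors of B.
  segment-powers : ∀ x lo l → segment (powers x lo) lo (suc l) ≡ superfalling (x + num (lo ℕ.+ l)) (suc l)
  segment-powers-tail : ∀ x lo l → segment (powers x lo) (suc lo) l ≡ superfalling (x + num (lo ℕ.+ l)) (suc l)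
  segment-powers x lo l = begin
    powers x lo lo * segment (powers x lo) (suc lo) l    ≡⟨ ≡.cong (λ e → (x + num lo) ^ e * segment (powers x lo) (suc lo) l) (ℕ.n∸n≡0 lo) ⟩
    1ℚ * segment (powers x lo) (suc lo) l                ≡⟨ ℚ.*-identityˡ _ ⟩
    segment (powers x lo) (suc lo) l                     ≡⟨ segment-powers-tail x lo l ⟩
    superfalling (x + num (lo ℕ.+ l)) (suc l)            ∎
  segment-powers-tail x lo zero    = ≡.refl
  segment-powers-tail x lo (suc l) = begin
    segment (powers x lo) (suc lo) (suc l)               ≡⟨ segment-cong (suc lo) (suc l) (λ k lo<k → ≡.cong ((x + num k) ^_) (ℕ.+-∸-assoc 1 lo<k)) ⟩
    segment (λ k → (x + num k) * powers x (suc lo) k) (suc lo) (suc l) ≡⟨ segment-* (λ k → x + num k) (powers x (suc lo)) (suc lo) (suc l) ⟩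
    segment (λ k → x + num k) (suc lo) (suc l) * segment (powers x (suc lo)) (suc lo) (suc l)
      ≡⟨ ≡.cong₂ _*_ (segment-falling x (suc lo) l) (segment-powers x (suc lo) l) ⟩
    falling y (suc l) * superfalling y (suc l)           ≡⟨ ℚ.*-comm (falling y (suc l)) (superfalling y (suc l)) ⟩
    superfalling y (suc (suc l))                         ≡⟨ ≡.cong (λ k → superfalling (x + num k) (suc (suc l))) (≡.sym (ℕ.+-suc lo l)) ⟩
    superfalling (x + num (lo ℕ.+ suc l)) (suc (suc l))  ∎
    where y = x + num (suc lo ℕ.+ l)

  -- Two steps restore the order of the numerator parameters, raise X and Y by 1 and Z by 2, and so
  -- lower Y - Z by 1.
  gaussCoeff-even : ∀ i X Y Z → (∀ m → m ℕ.< suc (suc (double i)) → Z + num m ≢ 0ℚ) →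
    gaussCoeff X Y Z (double i) * ((Z + num (double i)) * (Z + num (suc (double i)))) ≡ (X + num i) * (Y - Z - num i)
  gaussCoeff-even zero X Y Z Z≢0 = begin
    g * ((Z + 0ℚ) * (Z + (1ℚ + 0ℚ)))   ≡⟨ solve 2 (λ g Z → g :* ((Z :+ con 0ℚ) :* (Z :+ (con 1ℚ :+ con 0ℚ))) := g :* (Z :* (Z :+ con 1ℚ))) ≡.refl g Z ⟩
    g * (Z * (Z + 1ℚ))                 ≡⟨ gaussCoeff-clear X Y Z Z≢0 ⟩
    X * (Y - Z)                        ≡⟨ solve 3 (λ X Y Z → X :* (Y :- Z) := (X :+ con 0ℚ) :* (Y :- Z :- con 0ℚ)) ≡.refl X Y Z ⟩
    (X + 0ℚ) * (Y - Z - 0ℚ)            ∎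
    where g = gaussCoeff X Y Z 0
  gaussCoeff-even (suc i) X Y Z Z≢0 = begin
    g * ((Z + num (suc (suc d))) * (Z + num (suc (suc (suc d)))))
      ≡⟨ solve 3 (λ g Z n → g :* ((Z :+ (con 1ℚ :+ (con 1ℚ :+ n))) :* (Z :+ (con 1ℚ :+ (con 1ℚ :+ (con 1ℚ :+ n))))) := g :* ((Z :+ con 1ℚ :+ con 1ℚ :+ n) :* (Z :+ con 1ℚ :+ con 1ℚ :+ (con 1ℚ :+ n)))) ≡.refl g Z (num d) ⟩
    g * ((Z + 1ℚ + 1ℚ + num d) * (Z + 1ℚ + 1ℚ + num (suc d)))
      ≡⟨ gaussCoeff-even i (X + 1ℚ) (Y + 1ℚ) (Z + 1ℚ + 1ℚ) (+1-≢0 (Z + 1ℚ) (+1-≢0 Z Z≢0)) ⟩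
    (X + 1ℚ + num i) * (Y + 1ℚ - (Z + 1ℚ + 1ℚ) - num i)
      ≡⟨ solve 4 (λ X Y Z i → (X :+ con 1ℚ :+ i) :* (Y :+ con 1ℚ :- (Z :+ con 1ℚ :+ con 1ℚ) :- i) := (X :+ (con 1ℚ :+ i)) :* (Y :- Z :- (con 1ℚ :+ i))) ≡.refl X Y Z (num i) ⟩
    (X + num (suc i)) * (Y - Z - num (suc i)) ∎
    where
    d = double i
    g = gaussCoeff X Y Z (suc (suc d))

  gaussCoeff-odd : ∀ i X Y Z → (∀ m → m ℕ.< suc (suc (suc (double i))) → Z + num m ≢ 0ℚ) →
    gaussCoeff X Y Z (suc (double i)) * ((Z + num (suc (double i))) * (Z + num (suc (suc (double i))))) ≡ (Y + num (suc i)) * (X - Z - num (suc i))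
  gaussCoeff-odd i X Y Z Z≢0 = begin
    g * ((Z + num (suc d)) * (Z + num (suc (suc d))))
      ≡⟨ ≡.cong₂ (λ u v → g * (u * v)) (+-num-suc Z d) (+-num-suc Z (suc d)) ⟨
    g * ((Z + 1ℚ + num d) * (Z + 1ℚ + num (suc d)))
      ≡⟨ gaussCoeff-even i (Y + 1ℚ) X (Z + 1ℚ) (+1-≢0 Z Z≢0) ⟩
    (Y + 1ℚ + num i) * (X - (Z + 1ℚ) - num i)
      ≡⟨ solve 4 (λ X Y Z i → (Y :+ con 1ℚ :+ i) :* (X :- (Z :+ con 1ℚ) :- i) := (Y :+ (con 1ℚ :+ i)) :* (X :- Z :- (con 1ℚ :+ i))) ≡.refl X Y Z (num i) ⟩
    (Y + num (suc i)) * (X - Z - num (suc i)) ∎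
    where
    d = double i
    g = gaussCoeff X Y Z (suc d)

  segment-zero : ∀ (f : ℕ → ℚ) len → product {len} (λ i → f (toℕ i)) ≡ segment f 0 len
  segment-zero f len = product-segment len 0 (λ i → f (toℕ i)) f λ _ → ≡.refl

  module Evaluation (n : ℕ) (α β : ℚ) where
    open Parameters n α β

    N S X : ℚ
    N = num n
    S = α + β
    X = S + (N + N)

    h : ℕ → ℚ
    h = pivot N (quotient a b c)

    -- Each new pair of coefficients extends every falling factorial: the denominators are c + m =
    -- -(X - m), and the numerators are, up to sign, the next factors of the falling factorials of
    -- N, α + N, β + N and S + N. The signs occur in even number. The count for N is one ahead
    -- because ν = N already contributes a factor.
    pivot-closed : ∀ i → (∀ m → m ℕ.< double (suc i) → c + num m ≢ 0ℚ) →
      falling X (suc (double i)) * falling X (suc (suc (double i))) * h (suc i)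
        ≡ falling N (suc (suc i)) * (falling (α + N) (suc i) * falling (β + N) (suc i) * falling (S + N) i)
    -- The first coefficient -b / c does not come from Gauss's relation. It has a single denominator
    -- and gives no factor in S + N, so that falling factorial stays one behind those of α + N and β
    -- + N.
    pivot-closed zero c≢0 = begin
      1ℚ * (X - 0ℚ) * (1ℚ * (X - 0ℚ) * (X - (1ℚ + 0ℚ))) * (N * q₀ * q₁)
        ≡⟨ solve 5 (λ A B N p q → let X = A :+ B :+ (N :+ N) ; c = :- (N :+ N :+ (A :+ B)) in
             con 1ℚ :* (X :- con 0ℚ) :* (con 1ℚ :* (X :- con 0ℚ) :* (X :- (con 1ℚ :+ con 0ℚ))) :* (N :* p :* q)
             := :- N :* (c :* p) :* (q :* ((c :+ con 0ℚ) :* (c :+ (con 1ℚ :+ con 0ℚ))))) ≡.refl α β N q₀ q₁ ⟩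
      - N * (c * q₀) * (q₁ * ((c + num 0) * (c + num 1)))
        ≡⟨ ≡.cong₂ (λ u v → - N * u * v) (*-inv-cancel (c≢0 0 (s≤s z≤n) ∘ ≡.trans (ℚ.+-identityʳ c)) (- b)) (gaussCoeff-even 0 (a + 1ℚ) b c c≢0) ⟩
      - N * - b * ((a + 1ℚ + 0ℚ) * (b - c - 0ℚ))
        ≡⟨ solve 3 (λ A B N → let a = :- N ; b = :- (N :+ A) ; c = :- (N :+ N :+ (A :+ B)) in
             :- N :* :- b :* ((a :+ con 1ℚ :+ con 0ℚ) :* (b :- c :- con 0ℚ))
             := con 1ℚ :* (N :- con 0ℚ) :* (N :- (con 1ℚ :+ con 0ℚ)) :* (con 1ℚ :* (A :+ N :- con 0ℚ) :* (con 1ℚ :* (B :+ N :- con 0ℚ)) :* con 1ℚ)) ≡.refl α β N ⟩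
      falling N 2 * (falling (α + N) 1 * falling (β + N) 1 * 1ℚ) ∎
      where
      q₀ = quotient a b c 0
      q₁ = quotient a b c 1
    pivot-closed (suc i) c≢0 = begin
      f * (X - num (suc d)) * (X - num (suc (suc d))) * (f * (X - num (suc d)) * (X - num (suc (suc d))) * (X - num (suc (suc (suc d))))) * (h (suc i) * q₂ * q₃)
        ≡⟨ solve 8 (λ A B N f d h p q → let X = A :+ B :+ (N :+ N) ; c = :- (N :+ N :+ (A :+ B)) ; d₁ = con 1ℚ :+ d ; d₂ = con 1ℚ :+ d₁ ; d₃ = con 1ℚ :+ d₂ in
             f :* (X :- d₁) :* (X :- d₂) :* (f :* (X :- d₁) :* (X :- d₂) :* (X :- d₃)) :* (h :* p :* q)
             := f :* (f :* (X :- d₁)) :* h :* (p :* ((c :+ d₁) :* (c :+ d₂))) :* (q :* ((c :+ d₂) :* (c :+ d₃)))) ≡.refl α β N f (num d) (h (suc i)) q₂ q₃ ⟩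
      f * (f * (X - num (suc d))) * h (suc i) * (q₂ * ((c + num (suc d)) * (c + num (suc (suc d))))) * (q₃ * ((c + num (suc (suc d))) * (c + num (suc (suc (suc d))))))
        ≡⟨ ≡.cong₂ _*_ (≡.cong₂ _*_ (pivot-closed i λ m m<d → c≢0 m (ℕ.m<n⇒m<1+n (ℕ.m<n⇒m<1+n m<d)))
             (gaussCoeff-odd i (a + 1ℚ) b c λ m m<d → c≢0 m (ℕ.m<n⇒m<1+n m<d))) (gaussCoeff-even (suc i) (a + 1ℚ) b c c≢0) ⟩
      fN * (fα * fβ * fS) * ((b + num (suc i)) * (a + 1ℚ - c - num (suc i))) * ((a + 1ℚ + num (suc i)) * (b - c - num (suc i)))
        ≡⟨ solve 8 (λ A B N i fN fα fβ fS → let a = :- N ; b = :- (N :+ A) ; c = :- (N :+ N :+ (A :+ B)) ; i₁ = con 1ℚ :+ i ; i₂ = con 1ℚ :+ i₁ in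
             fN :* (fα :* fβ :* fS) :* ((b :+ i₁) :* (a :+ con 1ℚ :- c :- i₁)) :* ((a :+ con 1ℚ :+ i₁) :* (b :- c :- i₁))
             := fN :* (N :- i₂) :* (fα :* (A :+ N :- i₁) :* (fβ :* (B :+ N :- i₁)) :* (fS :* (A :+ B :+ N :- i)))) ≡.refl α β N (num i) fN fα fβ fS ⟩
      fN * (N - num (suc (suc i))) * (fα * (α + N - num (suc i)) * (fβ * (β + N - num (suc i))) * (fS * (S + N - num i))) ∎
      where
      d = double i
      f = falling X (suc d)
      q₂ = quotient a b c (double (suc i))
      q₃ = quotient a b c (suc (double (suc i)))
      fN = falling N (suc (suc i))
      fα = falling (α + N) (suc i)
      fβ = falling (β + N) (suc i)
      fS = falling (S + N) i

    -- Raising `τ` extends `superfalling X` by the two falling factorials that clear the denominator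
    -- of the new pivot, and each of the other products by one, so `pivot-closed` is the inductive
    -- step.
    pivots-closed : ∀ τ → (∀ m → m ℕ.< double τ → c + num m ≢ 0ℚ) →
      superfalling X (suc (double τ)) * segment h 0 (suc τ)
        ≡ superfalling N (suc (suc τ)) * (superfalling (α + N) (suc τ) * superfalling (β + N) (suc τ) * superfalling (S + N) τ)
    pivots-closed zero c≢0 = solve 1 (λ N → con 1ℚ :* con 1ℚ :* (N :* con 1ℚ)
      := con 1ℚ :* con 1ℚ :* (con 1ℚ :* (N :- con 0ℚ)) :* (con 1ℚ :* con 1ℚ :* (con 1ℚ :* con 1ℚ) :* con 1ℚ)) ≡.refl N
    pivots-closed (suc τ) c≢0 = begin
      s * f₁ * f₂ * segment h 0 (suc (suc τ))
        ≡⟨ ≡.cong (s * f₁ * f₂ *_) (segment-last h 0 (suc τ)) ⟩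
      s * f₁ * f₂ * (segment h 0 (suc τ) * h (suc τ))
        ≡⟨ solve 5 (λ s f g p h → s :* f :* g :* (p :* h) := s :* p :* (f :* g :* h)) ≡.refl s f₁ f₂ (segment h 0 (suc τ)) (h (suc τ)) ⟩
      s * segment h 0 (suc τ) * (f₁ * f₂ * h (suc τ))
        ≡⟨ ≡.cong₂ _*_ (pivots-closed τ λ m m<d → c≢0 m (ℕ.m<n⇒m<1+n (ℕ.m<n⇒m<1+n m<d))) (pivot-closed τ c≢0) ⟩
      sN * (sα * sβ * sS) * (fN * (fα * fβ * fS))
        ≡⟨ solve 8 (λ a b c d e f g h → a :* (b :* c :* d) :* (e :* (f :* g :* h)) := a :* e :* (b :* f :* (c :* g) :* (d :* h))) ≡.refl sN sα sβ sS fN fα fβ fS ⟩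
      sN * fN * (sα * fα * (sβ * fβ) * (sS * fS)) ∎
      where
      s = superfalling X (suc (double τ))
      f₁ = falling X (suc (double τ))
      f₂ = falling X (suc (suc (double τ)))
      sN = superfalling N (suc (suc τ))
      sα = superfalling (α + N) (suc τ)
      sβ = superfalling (β + N) (suc τ)
      sS = superfalling (S + N) τ
      fN = falling N (suc (suc τ))
      fα = falling (α + N) (suc τ)
      fβ = falling (β + N) (suc τ)
      fS = falling (S + N) τ

    module _ (τ : ℕ) (τ<n : τ ℕ.< n) where
      r : ℕ
      r = n ∸ suc τ

      r+t≡n : r ℕ.+ suc τ ≡ n
      r+t≡n = ℕ.m∸n+n≡m τ<n

      A-closed : A n (suc τ) ≡ superfalling N (suc (suc τ))
      A-closed = begin
        A n (suc τ)                                          ≡⟨ ∏ᵇ-segment (r ℕ.+ 1) n (suc τ) _ (powers 0ℚ r) (λ k _ _ → ≡.cong (_^ (k ∸ r)) (≡.trans (≡.sym (num≡fromℕ k)) (≡.sym (ℚ.+-identityˡ (num k))))) (≡.trans (≡.cong (ℕ._+ suc τ) (ℕ.+-comm r 1)) (≡.cong suc r+t≡n)) ⟩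
        segment (powers 0ℚ r) (r ℕ.+ 1) (suc τ)              ≡⟨ ≡.cong (λ lo → segment (powers 0ℚ r) lo (suc τ)) (ℕ.+-comm r 1) ⟩
        segment (powers 0ℚ r) (suc r) (suc τ)                ≡⟨ segment-powers-tail 0ℚ r (suc τ) ⟩
        superfalling (0ℚ + num (r ℕ.+ suc τ)) (suc (suc τ))  ≡⟨ ≡.cong (λ x → superfalling x (suc (suc τ))) (≡.trans (ℚ.+-identityˡ _) (≡.cong num r+t≡n)) ⟩
        superfalling N (suc (suc τ))                         ∎

      B-closed : B n (suc τ) α β ≡ superfalling (α + N) (suc τ) * superfalling (β + N) (suc τ) * superfalling (S + N) τ
      B-closed = begin
        B n (suc τ) α β
          ≡⟨ ∏ᵇ-segment (r ℕ.+ 2) n τ _ (λ k → powers α (suc r) k * powers β (suc r) k * powers S (suc (suc r)) k) factor (≡.trans (≡.cong (ℕ._+ τ) (ℕ.+-comm r 2)) (≡.cong suc 1+r+τ≡n)) ⟩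
        segment (λ k → powers α (suc r) k * powers β (suc r) k * powers S (suc (suc r)) k) (r ℕ.+ 2) τ
          ≡⟨ ≡.trans (segment-* (λ k → powers α (suc r) k * powers β (suc r) k) (powers S (suc (suc r))) (r ℕ.+ 2) τ) (≡.cong (_* segment (powers S (suc (suc r))) (r ℕ.+ 2) τ) (segment-* (powers α (suc r)) (powers β (suc r)) (r ℕ.+ 2) τ)) ⟩
        segment (powers α (suc r)) (r ℕ.+ 2) τ * segment (powers β (suc r)) (r ℕ.+ 2) τ * segment (powers S (suc (suc r))) (r ℕ.+ 2) τ
          ≡⟨ ≡.cong (λ lo → segment (powers α (suc r)) lo τ * segment (powers β (suc r)) lo τ * segment (powers S (suc (suc r))) lo τ) (ℕ.+-comm r 2) ⟩
        segment (powers α (suc r)) (suc (suc r)) τ * segment (powers β (suc r)) (suc (suc r)) τ * segment (powers S (suc (suc r))) (suc (suc r)) τ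
          ≡⟨ ≡.cong₂ _*_ (≡.cong₂ _*_ (tail α) (tail β)) (full τ 1+r+τ≡n) ⟩
        superfalling (α + N) (suc τ) * superfalling (β + N) (suc τ) * superfalling (S + N) τ ∎
        where
        1+r+τ≡n : suc r ℕ.+ τ ≡ n
        1+r+τ≡n = ≡.trans (≡.sym (ℕ.+-suc r τ)) r+t≡n
        factor : ∀ k (p : r ℕ.+ 2 ≤ k) (q : k ≤ n) → ((α + fromℕ k) * (β + fromℕ k)) ^ (k ∸ (r ℕ.+ 1)) * (S + fromℕ k) ^ (k ∸ (r ℕ.+ 2))
          ≡ powers α (suc r) k * powers β (suc r) k * powers S (suc (suc r)) k
        factor k _ _ = begin
          ((α + fromℕ k) * (β + fromℕ k)) ^ (k ∸ (r ℕ.+ 1)) * (S + fromℕ k) ^ (k ∸ (r ℕ.+ 2))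
            ≡⟨ ≡.cong₂ (λ u v → ((α + fromℕ k) * (β + fromℕ k)) ^ (k ∸ u) * (S + fromℕ k) ^ (k ∸ v)) (ℕ.+-comm r 1) (ℕ.+-comm r 2) ⟩
          ((α + fromℕ k) * (β + fromℕ k)) ^ (k ∸ suc r) * (S + fromℕ k) ^ (k ∸ suc (suc r))
            ≡⟨ ≡.cong (_* (S + fromℕ k) ^ (k ∸ suc (suc r))) (^-distrib-* (α + fromℕ k) (β + fromℕ k) (k ∸ suc r)) ⟩
          (α + fromℕ k) ^ (k ∸ suc r) * (β + fromℕ k) ^ (k ∸ suc r) * (S + fromℕ k) ^ (k ∸ suc (suc r))
            ≡⟨ ≡.cong (λ x → (α + x) ^ (k ∸ suc r) * (β + x) ^ (k ∸ suc r) * (S + x) ^ (k ∸ suc (suc r))) (num≡fromℕ k) ⟨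
          powers α (suc r) k * powers β (suc r) k * powers S (suc (suc r)) k ∎
        tail : ∀ x → segment (powers x (suc r)) (suc (suc r)) τ ≡ superfalling (x + N) (suc τ)
        tail x = ≡.trans (segment-powers-tail x (suc r) τ) (≡.cong (λ k → superfalling (x + num k) (suc τ)) 1+r+τ≡n)
        -- The exponents of α + β + j start at 0, so `segment-powers` applies; it requires a
        -- nonempty range, and the empty one is `superfalling` at 0.
        full : ∀ τ → suc r ℕ.+ τ ≡ n → segment (powers S (suc (suc r))) (suc (suc r)) τ ≡ superfalling (S + N) τ
        full zero    _  = ≡.refl
        full (suc τ) eq = ≡.trans (segment-powers S (suc (suc r)) τ) (≡.cong (λ k → superfalling (S + num k) (suc τ)) (≡.trans (≡.sym (ℕ.+-suc (suc r) τ)) eq))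

      lo+double≡2n : 2 ℕ.* n ∸ 2 ℕ.* suc τ ℕ.+ 2 ℕ.+ double τ ≡ 2 ℕ.* n
      lo+double≡2n = begin
        2 ℕ.* n ∸ 2 ℕ.* suc τ ℕ.+ 2 ℕ.+ double τ    ≡⟨ ℕ.+-assoc (2 ℕ.* n ∸ 2 ℕ.* suc τ) 2 (double τ) ⟩
        2 ℕ.* n ∸ 2 ℕ.* suc τ ℕ.+ double (suc τ)    ≡⟨ ≡.cong (2 ℕ.* n ∸ 2 ℕ.* suc τ ℕ.+_) (≡.trans (double≡+ (suc τ)) (≡.cong (suc τ ℕ.+_) (≡.sym (ℕ.+-identityʳ (suc τ))))) ⟩
        2 ℕ.* n ∸ 2 ℕ.* suc τ ℕ.+ 2 ℕ.* suc τ       ≡⟨ ℕ.m∸n+n≡m (ℕ.*-monoʳ-≤ 2 τ<n) ⟩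
        2 ℕ.* n                                     ∎

      C-closed : C n (suc τ) α β ≡ superfalling X (suc (double τ))
      C-closed = begin
        C n (suc τ) α β                              ≡⟨ ∏ᵇ-segment lo (2 ℕ.* n) (suc (double τ)) _ (powers S lo) (λ k _ _ → ≡.cong (λ x → (S + x) ^ (k ∸ lo)) (≡.sym (num≡fromℕ k))) (≡.trans (ℕ.+-suc lo (double τ)) (≡.cong suc lo+double≡2n)) ⟩
        segment (powers S lo) lo (suc (double τ))    ≡⟨ segment-powers S lo (double τ) ⟩
        superfalling (S + num (lo ℕ.+ double τ)) (suc (double τ))
          ≡⟨ ≡.cong (λ x → superfalling (S + x) (suc (double τ))) (≡.trans (≡.cong num (≡.trans lo+double≡2n (≡.cong (n ℕ.+_) (ℕ.+-identityʳ n)))) (num-+ n n)) ⟩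
        superfalling X (suc (double τ))              ∎
        where lo = 2 ℕ.* n ∸ 2 ℕ.* suc τ ℕ.+ 2

      module _ (h₂ : ∀ j → 2 ℕ.* n ∸ 2 ℕ.* suc τ ℕ.+ 3 ≤ j → j ≤ 2 ℕ.* n → α + β + fromℕ j ≢ 0ℚ) where

        regular : ∀ m → m ℕ.< double τ → c + num m ≢ 0ℚ
        regular m m<d = c+num≢0 m m≤2n (h₂ (2 ℕ.* n ∸ m) (ℕ.m+n≤o⇒m≤o∸n (2 ℕ.* n ∸ 2 ℕ.* suc τ ℕ.+ 3) lower) (ℕ.m∸n≤m (2 ℕ.* n) m))
          where
          lower : 2 ℕ.* n ∸ 2 ℕ.* suc τ ℕ.+ 3 ℕ.+ m ≤ 2 ℕ.* n
          lower = ℕ.≤-trans (ℕ.≤-reflexive (≡.trans (ℕ.+-assoc w 3 m) (≡.sym (ℕ.+-assoc w 2 (suc m))))) (ℕ.≤-trans (ℕ.+-monoʳ-≤ (w ℕ.+ 2) m<d) (ℕ.≤-reflexive lo+double≡2n))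
            where w = 2 ℕ.* n ∸ 2 ℕ.* suc τ
          m≤2n : m ≤ 2 ℕ.* n
          m≤2n = ℕ.≤-trans (ℕ.m≤n+m m _) lower

        product-pivots : product {suc τ} (λ i → h (toℕ i)) ≡ _÷_ (A n (suc τ) * B n (suc τ) α β) (C n (suc τ) α β) {{C-nonZero n (suc τ) α β h₂}}
        product-pivots = begin
          product {suc τ} (λ i → h (toℕ i))                 ≡⟨ segment-zero h (suc τ) ⟩
          P                                                 ≡⟨ ℚ.*-identityˡ P ⟨
          1ℚ * P                                            ≡⟨ ≡.cong (_* P) (ℚ.*-inverseʳ Cₜ {{C-nonZero n (suc τ) α β h₂}}) ⟨
          Cₜ * i * P                                        ≡⟨ solve 3 (λ c i p → c :* i :* p := c :* p :* i) ≡.refl Cₜ i P ⟩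
          Cₜ * P * i                                        ≡⟨ ≡.cong (_* i) (≡.trans (≡.cong (_* P) C-closed) (≡.trans (pivots-closed τ regular) (≡.sym (≡.cong₂ _*_ A-closed B-closed)))) ⟩
          A n (suc τ) * B n (suc τ) α β * i                 ∎
          where
          P = segment h 0 (suc τ)
          Cₜ = C n (suc τ) α β
          i = 1/_ Cₜ {{C-nonZero n (suc τ) α β h₂}}

-- Hankel determinants of the roots in the algebraic closure

module _ {k ℓ₁ ℓ₂} (Q̄ : AlgebraicClosureOfℚ k ℓ₁ ℓ₂) where
  open AlgebraicClosureOfℚ Q̄
  open CommutativeRing commutativeRing
    using (1#; refl; sym; trans; reflexive; setoid; +-cong; +-congˡ; +-congʳ; *-cong; *-congˡ; *-congʳ; *-identityˡ; *-identityʳ; *-monoid; +-group)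
    renaming (_+_ to _⊕_; _*_ to _⊗_)
  open IsRingHomomorphism ι-isRingHomomorphism using (+-homo; *-homo; 0#-homo; 1#-homo)
  open import Algebra.Properties.Group +-group using () renaming (∙-cancelʳ to +-cancelʳ)
  open import Algebra.Properties.Monoid.Sum *-monoid using () renaming (sum-cong-≋ to product-cong)
  open RawSemiringDefs (RawRing.rawSemiring rawRing) using () renaming (_×_ to _·_; product to productK)
  open Roots commutativeRing using (reversed; reversed-zero; reversed-above; coeff-·ₚ; coeff-∏X-; newton)
  open Series commutativeRing using (_⊛_; ⊛-cong)
  open SFraction commutativeRing using (hankel-product) renaming (pivot to pivotK)
  open import Relation.Binary.Reasoning.Setoid setoid

  ι-num : ∀ m → ι (num m) ≈ m · 1#
  ι-num zero    = 0#-homo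
  ι-num (suc m) = trans (+-homo 1ℚ (num m)) (+-cong 1#-homo (ι-num m))

  ι-product : ∀ m (f : Fin m → ℚ) → ι (product f) ≈ productK (ι ∘ f)
  ι-product zero    f = 1#-homo
  ι-product (suc m) f = trans (*-homo (f zero) (product (f ∘ suc))) (*-congˡ (ι-product m (f ∘ suc)))

  ι-pivot : ∀ ν c i → ι (pivot ν c i) ≈ pivotK (ι ν) (ι ∘ c) i
  ι-pivot ν c zero    = refl
  ι-pivot ν c (suc i) = trans (*-homo (pivot ν c i * c (double i)) (c (suc (double i)))) (*-congʳ (trans (*-homo (pivot ν c i) (c (double i))) (*-congʳ (ι-pivot ν c i))))

  coeff-map-tabulate : ∀ {m} (f : Fin m → ℚ) i → coeff (map ι (tabulate f)) (toℕ i) ≡ ι (f i)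
  coeff-map-tabulate {suc m} f zero    = ≡.refl
  coeff-map-tabulate {suc m} f (suc i) = coeff-map-tabulate (f ∘ suc) i

  module _ (n : ℕ) (α β : ℚ) (h₁ : ∀ j → n ℕ.+ 1 ≤ j → j ≤ 2 ℕ.* n → α + β + fromℕ j ≢ 0ℚ)
    (θ : Fin n → Carrier) (roots : AreRootsOf θ (map ι (jacobi n α β h₁))) where
    open Parameters n α β

    coeff-jacobi : ∀ i j → i ℕ.+ j ≡ n → coeff (map ι (jacobi n α β h₁)) i ≈ ι (₂F₁ a b c j)
    coeff-jacobi i j eq = begin
      coeff (map ι (jacobi n α β h₁)) i          ≡⟨ ≡.cong (coeff (map ι (jacobi n α β h₁))) (Fin.toℕ-fromℕ< i<1+n) ⟨
      coeff (map ι (jacobi n α β h₁)) (toℕ i′)   ≡⟨ coeff-map-tabulate (λ j → jacobiCoeff n α β h₁ (toℕ j)) i′ ⟩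
      ι (jacobiCoeff n α β h₁ (toℕ i′))          ≡⟨ ≡.cong (ι ∘ jacobiCoeff n α β h₁) (Fin.toℕ-fromℕ< i<1+n) ⟩
      ι (jacobiCoeff n α β h₁ i)                 ≡⟨ ≡.cong ι (jacobiCoeff≡₂F₁ h₁ i j eq) ⟩
      ι (₂F₁ a b c j)                            ∎
      where
      i<1+n : i ℕ.< suc n
      i<1+n = s≤s (≡.subst (i ≤_) eq (ℕ.m≤m+n i j))
      i′ = fromℕ< i<1+n

    scaled-reversed : ∀ j → j ≤ n → ι (₂F₁ a b c j) ≈ proj₁ roots ⊗ reversed θ j
    scaled-reversed j j≤n = begin
      ι (₂F₁ a b c j)                          ≈⟨ coeff-jacobi (n ∸ j) j (ℕ.m∸n+n≡m j≤n) ⟨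
      coeff (map ι (jacobi n α β h₁)) (n ∸ j)  ≈⟨ proj₂ (proj₂ roots) (n ∸ j) ⟩
      coeff (u ·ₚ ∏X- θ) (n ∸ j)               ≈⟨ coeff-·ₚ u (∏X- θ) (n ∸ j) ⟩
      u ⊗ coeff (∏X- θ) (n ∸ j)                ≈⟨ *-congˡ (coeff-∏X- θ (n ∸ j) j (ℕ.m∸n+n≡m j≤n)) ⟩
      u ⊗ reversed θ j                         ∎
      where u = proj₁ roots

    -- `AreRootsOf` leaves a scalar free; comparing leading coefficients, which are the constant
    -- terms after reversal, fixes it.
    leading≈1 : proj₁ roots ≈ 1#
    leading≈1 = begin
      proj₁ roots                    ≈⟨ *-identityʳ _ ⟨
      proj₁ roots ⊗ 1#               ≈⟨ *-congˡ (reversed-zero θ) ⟨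
      proj₁ roots ⊗ reversed θ 0     ≈⟨ scaled-reversed 0 z≤n ⟨
      ι 1ℚ                           ≈⟨ 1#-homo ⟩
      1#                             ∎

    -- Beyond order n some c + m may vanish, but there the numerator factor (-n)ⱼ is zero, so the
    -- default value of `inv` does no harm and the equality holds at every order.
    reversed≈₂F₁ : ∀ j → reversed θ j ≈ ι (₂F₁ a b c j)
    reversed≈₂F₁ j with ℕ.≤-<-connex j n
    ... | inj₁ j≤n = sym (trans (scaled-reversed j j≤n) (trans (*-congʳ leading≈1) (*-identityˡ _)))
    ... | inj₂ n<j = trans (reversed-above θ j n<j) (sym (trans (reflexive (≡.cong ι ₂F₁≡0)) 0#-homo))
      where
      ₂F₁≡0 : ₂F₁ a b c j ≡ 0ℚ
      ₂F₁≡0 = ≡.trans (≡.cong (λ r → r * rising b j * inv (rising c j * rising 1ℚ j)) (rising-negative n j n<j))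
        (≡.trans (≡.cong (_* inv (rising c j * rising 1ℚ j)) (ℚ.*-zeroˡ (rising b j))) (ℚ.*-zeroˡ (inv (rising c j * rising 1ℚ j))))

    -- The relation n F - z F′ = n ₂F₁(a + 1, b; c; z), which is `₂F₁-raiseˡ` at a = -n with the
    -- derivative kept on the left.
    derivative-series : ∀ j → num n * ₂F₁ (a + 1ℚ) b c j + num j * ₂F₁ a b c j ≡ num n * ₂F₁ a b c j
    derivative-series j = ≡.trans
      (solve 4 (λ N J x y → N :* y :+ J :* x := :- (:- N :* y) :+ J :* x) ≡.refl (num n) (num j) (₂F₁ a b c j) (₂F₁ (a + 1ℚ) b c j))
      (≡.trans (≡.cong (λ u → - u + num j * ₂F₁ a b c j) (₂F₁-raiseˡ a b c j))
        (solve 3 (λ N J x → :- ((:- N :+ J) :* x) :+ J :* x := N :* x) ≡.refl (num n) (num j) (₂F₁ a b c j)))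
      where open +-*-Solver using (solve; _:=_; _:+_; _:*_; :-_)

    -- Newton's identities and `derivative-series` share the summand j Fⱼ and the right-hand side n
    -- Fⱼ; cancelling that summand identifies S F with n ₂F₁(a + 1, b; c; z).
    powerSum-⊛ : ∀ j → (powerSum θ ⊛ (ι ∘ ₂F₁ a b c)) j ≈ ι (num n) ⊗ ι (₂F₁ (a + 1ℚ) b c j)
    powerSum-⊛ j = +-cancelʳ (ι (num j) ⊗ ι (₂F₁ a b c j)) _ _ (begin
      (powerSum θ ⊛ (ι ∘ ₂F₁ a b c)) j ⊕ ι (num j) ⊗ ι (₂F₁ a b c j)
        ≈⟨ +-cong (⊛-cong (λ _ → refl) reversed≈₂F₁ j) (*-cong (sym (ι-num j)) (reversed≈₂F₁ j)) ⟨
      (powerSum θ ⊛ reversed θ) j ⊕ (j · 1#) ⊗ reversed θ j             ≈⟨ newton θ j ⟩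
      (n · 1#) ⊗ reversed θ j                                           ≈⟨ *-cong (sym (ι-num n)) (reversed≈₂F₁ j) ⟩
      ι (num n) ⊗ ι (₂F₁ a b c j)                                       ≈⟨ *-homo (num n) (₂F₁ a b c j) ⟨
      ι (num n * ₂F₁ a b c j)                                           ≡⟨ ≡.cong ι (derivative-series j) ⟨
      ι (num n * ₂F₁ (a + 1ℚ) b c j + num j * ₂F₁ a b c j)              ≈⟨ +-homo (num n * ₂F₁ (a + 1ℚ) b c j) (num j * ₂F₁ a b c j) ⟩
      ι (num n * ₂F₁ (a + 1ℚ) b c j) ⊕ ι (num j * ₂F₁ a b c j)          ≈⟨ +-cong (*-homo (num n) (₂F₁ (a + 1ℚ) b c j)) (*-homo (num j) (₂F₁ a b c j)) ⟩
      ι (num n) ⊗ ι (₂F₁ (a + 1ℚ) b c j) ⊕ ι (num j) ⊗ ι (₂F₁ a b c j)  ∎)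

    Δ-closed : ∀ τ → τ ℕ.< n →
      (h₂ : ∀ j → 2 ℕ.* n ∸ 2 ℕ.* suc τ ℕ.+ 3 ≤ j → j ≤ 2 ℕ.* n → α + β + fromℕ j ≢ 0ℚ) →
      Δ θ (suc τ) ≈ ι (_÷_ (A n (suc τ) * B n (suc τ) α β) (C n (suc τ) α β) {{C-nonZero n (suc τ) α β h₂}})
    Δ-closed τ τ<n h₂ = begin
      Δ θ (suc τ)
        ≈⟨ hankel-product (double τ) (ι (num n)) (powerSum θ) (ι ∘ quotient a b c) (λ k → ι ∘ remainder a b c k)
             (λ k → trans (reflexive (≡.cong ι (remainder-zero a b c k))) 1#-homo) step powerSum-⊛ τ ≡.refl ⟩
      productK {suc τ} (λ i → pivotK (ι (num n)) (ι ∘ quotient a b c) (toℕ i))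
        ≈⟨ product-cong {suc τ} (λ i → ι-pivot (num n) (quotient a b c) (toℕ i)) ⟨
      productK {suc τ} (λ i → ι (h (toℕ i)))     ≈⟨ ι-product (suc τ) (λ i → h (toℕ i)) ⟨
      ι (product {suc τ} λ i → h (toℕ i))      ≡⟨ ≡.cong ι (product-pivots τ τ<n h₂) ⟩
      ι _                                       ∎
      where
      open Evaluation n α β
      step : ∀ k j → k ℕ.+ j ℕ.< double τ →
        ι (remainder a b c k (suc j)) ≈ ι (remainder a b c (suc k) (suc j)) ⊕ ι (quotient a b c k) ⊗ ι (remainder a b c (suc (suc k)) j)
      step k j k+j<T = trans (reflexive (≡.cong ι (remainder-step a b c (double τ) (regular τ τ<n h₂) k j k+j<T)))
        (trans (+-homo (remainder a b c (suc k) (suc j)) _) (+-congˡ (*-homo (quotient a b c k) (remainder a b c (suc (suc k)) j))))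

theorem13 : ∀ {c ℓ₁ ℓ₂} (Q̄ : AlgebraicClosureOfℚ c ℓ₁ ℓ₂) →
    let open AlgebraicClosureOfℚ Q̄ in
    (n t : ℕ) → 2 ≤ n → 1 ≤ t → t ≤ n →
    (α β : ℚ) →
    (h₁ : ∀ j → n ℕ.+ 1 ≤ j → j ≤ 2 ℕ.* n → α + β + fromℕ j ≢ 0ℚ) →
    (h₂ : ∀ j → 2 ℕ.* n ∸ 2 ℕ.* t ℕ.+ 3 ≤ j → j ≤ 2 ℕ.* n → α + β + fromℕ j ≢ 0ℚ) →
    (θ : Fin n → Carrier) → AreRootsOf θ (map ι (jacobi n α β h₁)) →
    Δ θ t ≈ ι (_÷_ (A n t * B n t α β) (C n t α β) {{C-nonZero n t α β h₂}})
theorem13 Q̄ n (suc τ) _ _ τ<n α β h₁ h₂ θ roots = Δ-closed Q̄ n α β h₁ θ roots τ τ<n h₂
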